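{- Let $f$ be an indefinite integral binary quadratic form of non-square discriminant. Under the labelling of the edges of the çark $\langle M_f\rangle\backslash\mathcal{F}$ by the forms of the class $[f]$, where the edge $\langle M_f\rangle\cdot\{W\}$ is labelled by $W\cdot f$, the reduced forms in the class $[f]$ are in one-to-one correspondence with the reduced edges of the çark.
   Context: Forms. $f=(A,B,C)$ denotes $f(x,y)=Ax^2+Bxy+Cy^2$ with $A,B,C\in\mathbf{Z}$, discriminant $\Delta=B^2-4AC$; it is indefinite if $\Delta>0$. $\mathrm{PSL}_2(\mathbf{Z})$ acts by $(U\cdot f)(x,y)=f(U(x,y)^t)$, and $[f]$ is the orbit of $f$. The stabilizer $\mathrm{Aut}(f)$ is infinite cyclic; let $M_f=\begin{pmatrix}p&q\\ r&s\end{pmatrix}$ be the generator of $\mathrm{Aut}(f)$ for which $\mathrm{sgn}(p+s)\,(r,s-p,-q)$ is a positive multiple of $f$. $M_f$ is hyperbolic. The form $f$ is reduced if (Gauss) $\bigl|\sqrt{\Delta}-2|A|\bigr|<B<\sqrt{\Delta}$. Çarks. Let $S(z)=-1/z$, $R(z)=(z-1)/z$. The bipartite Farey tree $\mathcal{F}$ has edges $\{W\}$, $\otimes$-vertices $\{W,WS\}$, $\bullet$-vertices $\{W,WR,WR^2\}$ ($W\in\mathrm{PSL}_2(\mathbf{Z})$); the edge $\{W\}$ joins $\{W,WS\}$ to $\{W,WR,WR^2\}$. $\mathrm{PSL}_2(\mathbf{Z})$ acts on it by left multiplication. $\mathcal{F}$ is realized in the upper half plane $\mathcal{H}$ as the $\mathrm{PSL}_2(\mathbf{Z})$-orbit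 of the geodesic arc (the edge $\{I\}$) from $i$ (the $\otimes$-vertex $\{I,S\}$) to $e^{i\pi/3}$ (the $\bullet$-vertex $\{I,R,R^2\}$). The quotient $\langle M_f\rangle\backslash\mathcal{F}$ is the çark of the class $[f]$; it is embedded in the annulus $\langle M_f\rangle\backslash\mathcal{H}$, and its unique circuit, the image of the axis of $M_f$ in $\mathcal{F}$, is its spine, directed by the translation direction of $M_f$. The annulus is viewed, compatibly with orientation, as a round annulus in the plane with the spine running counterclockwise, so the inner boundary component lies to the left of the directed spine and the outer one to the right. Each $\bullet$-vertex on the spine has two edges on the spine and one edge off the spine, from which an infinite Farey branch grows towards the inner or the outer boundary component. A maximal run of consecutive branches along the spine going towards the same boundary component is a Farey component. An edge of the spine is reduced if it is on either side of a Farey component in the direction of the inner boundary component; that is, it joins a $\bullet$-vertex $v$ of the spine whose branch goes to the inner boundary to a $\otimes$-vertex whose other neighbour on the spine is a $\bullet$-vertex whose branch goes to the outer boundary. -}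

module Defs where

open import Algebra.Bundles using (Group)
open import Data.Integer using (ℤ; +_; -[1+_]; +[1+_]; +0; 0ℤ; 1ℤ; _+_; _*_; _-_; -_; ∣_∣; _<_; _≤_)
  renaming (suc to sucℤ; pred to predℤ)
import Data.Integer.Properties as ℤₚ
open import Data.Integer.Tactic.RingSolver using (solve-∀)
open import Data.Nat using (ℕ; zero; suc; NonZero)
open import Data.Product using (Σ; Σ-syntax; ∃-syntax; _×_; _,_; proj₁; proj₂)
open import Data.Sum using (_⊎_; inj₁; inj₂)
open import Level using (0ℓ)
open import Relation.Binary.Bundles using (Setoid)
import Relation.Binary.Construct.On as On
open import Relation.Binary.PropositionalEquality using (_≡_; refl; sym; trans; cong; cong₂; setoid)
open import Relation.Nullary using (¬_)

infixl 7 _∙ₘ_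

record Mat : Set where
  constructor mat
  field a b c d : ℤ

det : Mat → ℤ
det (mat a b c d) = a * d - b * c

_∙ₘ_ : Mat → Mat → Mat
mat a b c d ∙ₘ mat a′ b′ c′ d′ =
  mat (a * a′ + b * c′) (a * b′ + b * d′) (c * a′ + d * c′) (c * b′ + d * d′)

1ₘ : Mat
1ₘ = mat 1ℤ 0ℤ 0ℤ 1ℤ

-ₘ_ : Mat → Mat
-ₘ mat a b c d = mat (- a) (- b) (- c) (- d)

adj : Mat → Mat
adj (mat a b c d) = mat d (- b) (- c) a

-- Elements of PSL₂(ℤ) are represented by matrices of determinant 1, equal up to sign.
record SL₂ : Set where
  constructor ⟪_,_⟫
  field
    matrix : Mat
    det≡1  : det matrix ≡ 1ℤ
  open Mat matrix public

open SL₂ using (matrix)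

infix 4 _≈_ _≉_

_≈_ : SL₂ → SL₂ → Set
U ≈ V = matrix U ≡ matrix V ⊎ matrix U ≡ -ₘ matrix V

_≉_ : SL₂ → SL₂ → Set
U ≉ V = ¬ (U ≈ V)

private
  mat-≡ : ∀ {a b c d a′ b′ c′ d′} → a ≡ a′ → b ≡ b′ → c ≡ c′ → d ≡ d′ →
          mat a b c d ≡ mat a′ b′ c′ d′
  mat-≡ refl refl refl refl = refl

  det-∙ : ∀ a b c d a′ b′ c′ d′ →
          (a * a′ + b * c′) * (c * b′ + d * d′) - (a * b′ + b * d′) * (c * a′ + d * c′)
          ≡ (a * d - b * c) * (a′ * d′ - b′ * c′)
  det-∙ = solve-∀

  det-adj : ∀ a b c d → d * a - (- b) * (- c) ≡ a * d - b * c
  det-adj = solve-∀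

  ∙-assoc-entry : ∀ a b a′ b′ c′ d′ x y →
    (a * a′ + b * c′) * x + (a * b′ + b * d′) * y ≡ a * (a′ * x + b′ * y) + b * (c′ * x + d′ * y)
  ∙-assoc-entry = solve-∀

  1-left₁ : ∀ x y → 1ℤ * x + 0ℤ * y ≡ x
  1-left₁ = solve-∀

  1-left₂ : ∀ x y → 0ℤ * x + 1ℤ * y ≡ y
  1-left₂ = solve-∀

  1-right₁ : ∀ x y → x * 1ℤ + y * 0ℤ ≡ x
  1-right₁ = solve-∀

  1-right₂ : ∀ x y → x * 0ℤ + y * 1ℤ ≡ y
  1-right₂ = solve-∀

  adj-l₁ : ∀ a b c d → d * a + - b * c ≡ a * d - b * c
  adj-l₁ = solve-∀

  adj-l₂ : ∀ b d → d * b + - b * d ≡ 0ℤ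
  adj-l₂ = solve-∀

  adj-l₃ : ∀ a c → - c * a + a * c ≡ 0ℤ
  adj-l₃ = solve-∀

  adj-l₄ : ∀ a b c d → - c * b + a * d ≡ a * d - b * c
  adj-l₄ = solve-∀

  adj-r₁ : ∀ a b c d → a * d + b * - c ≡ a * d - b * c
  adj-r₁ = solve-∀

  adj-r₂ : ∀ a b → a * - b + b * a ≡ 0ℤ
  adj-r₂ = solve-∀

  adj-r₃ : ∀ c d → c * d + d * - c ≡ 0ℤ
  adj-r₃ = solve-∀

  adj-r₄ : ∀ a b c d → c * - b + d * a ≡ a * d - b * c
  adj-r₄ = solve-∀

  neg-l : ∀ x y z w → - x * z + - y * w ≡ - (x * z + y * w)
  neg-l = solve-∀

  neg-r : ∀ x y z w → x * - z + y * - w ≡ - (x * z + y * w)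
  neg-r = solve-∀

  neg-∙ˡ : ∀ X Y → (-ₘ X) ∙ₘ Y ≡ -ₘ (X ∙ₘ Y)
  neg-∙ˡ (mat a b c d) (mat a′ b′ c′ d′) =
    mat-≡ (neg-l a b a′ c′) (neg-l a b b′ d′) (neg-l c d a′ c′) (neg-l c d b′ d′)

  neg-∙ʳ : ∀ X Y → X ∙ₘ (-ₘ Y) ≡ -ₘ (X ∙ₘ Y)
  neg-∙ʳ (mat a b c d) (mat a′ b′ c′ d′) =
    mat-≡ (neg-r a b a′ c′) (neg-r a b b′ d′) (neg-r c d a′ c′) (neg-r c d b′ d′)

  neg-neg : ∀ X → -ₘ (-ₘ X) ≡ X
  neg-neg (mat a b c d) = mat-≡ (ℤₚ.neg-involutive a) (ℤₚ.neg-involutive b)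
                                (ℤₚ.neg-involutive c) (ℤₚ.neg-involutive d)

  ≈-sym : ∀ {U V} → U ≈ V → V ≈ U
  ≈-sym         (inj₁ p) = inj₁ (sym p)
  ≈-sym {V = V} (inj₂ p) = inj₂ (trans (sym (neg-neg (matrix V))) (cong -ₘ_ (sym p)))

  ≈-trans : ∀ {U V W} → U ≈ V → V ≈ W → U ≈ W
  ≈-trans         (inj₁ p) (inj₁ q) = inj₁ (trans p q)
  ≈-trans         (inj₁ p) (inj₂ q) = inj₂ (trans p q)
  ≈-trans         (inj₂ p) (inj₁ q) = inj₂ (trans p (cong -ₘ_ q))
  ≈-trans {W = W} (inj₂ p) (inj₂ q) = inj₁ (trans p (trans (cong -ₘ_ q) (neg-neg (matrix W))))

infixl 7 _∙_

_∙_ : SL₂ → SL₂ → SL₂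
⟪ mat a b c d , p ⟫ ∙ ⟪ mat a′ b′ c′ d′ , p′ ⟫ =
  ⟪ mat a b c d ∙ₘ mat a′ b′ c′ d′
  , trans (det-∙ a b c d a′ b′ c′ d′) (cong₂ _*_ p p′) ⟫

𝟙 : SL₂
𝟙 = ⟪ 1ₘ , refl ⟫

_⁻¹ : SL₂ → SL₂
⟪ mat a b c d , p ⟫ ⁻¹ = ⟪ adj (mat a b c d) , trans (det-adj a b c d) p ⟫

private
  ∙-cong : ∀ {U U′ V V′} → U ≈ U′ → V ≈ V′ → U ∙ V ≈ U′ ∙ V′
  ∙-cong (inj₁ p) (inj₁ q) = inj₁ (cong₂ _∙ₘ_ p q)
  ∙-cong {U′ = U′} {V′ = V′} (inj₁ p) (inj₂ q) =
    inj₂ (trans (cong₂ _∙ₘ_ p q) (neg-∙ʳ (matrix U′) (matrix V′)))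
  ∙-cong {U′ = U′} {V′ = V′} (inj₂ p) (inj₁ q) =
    inj₂ (trans (cong₂ _∙ₘ_ p q) (neg-∙ˡ (matrix U′) (matrix V′)))
  ∙-cong {U′ = U′} {V′ = V′} (inj₂ p) (inj₂ q) =
    inj₁ (trans (cong₂ _∙ₘ_ p q)
         (trans (neg-∙ˡ (matrix U′) (-ₘ matrix V′))
         (trans (cong -ₘ_ (neg-∙ʳ (matrix U′) (matrix V′)))
                (neg-neg (matrix U′ ∙ₘ matrix V′)))))

  ∙-assoc : ∀ U V W → (U ∙ V) ∙ W ≈ U ∙ (V ∙ W)
  ∙-assoc ⟪ mat a b c d , _ ⟫ ⟪ mat a′ b′ c′ d′ , _ ⟫ ⟪ mat x y z w , _ ⟫ =
    inj₁ (mat-≡ (∙-assoc-entry a b a′ b′ c′ d′ x z) (∙-assoc-entry a b a′ b′ c′ d′ y w)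
                (∙-assoc-entry c d a′ b′ c′ d′ x z) (∙-assoc-entry c d a′ b′ c′ d′ y w))

  ∙-identityˡ : ∀ U → 𝟙 ∙ U ≈ U
  ∙-identityˡ ⟪ mat a b c d , _ ⟫ =
    inj₁ (mat-≡ (1-left₁ a c) (1-left₁ b d) (1-left₂ a c) (1-left₂ b d))

  ∙-identityʳ : ∀ U → U ∙ 𝟙 ≈ U
  ∙-identityʳ ⟪ mat a b c d , _ ⟫ =
    inj₁ (mat-≡ (1-right₁ a b) (1-right₂ a b) (1-right₁ c d) (1-right₂ c d))

  ∙-inverseˡ : ∀ U → U ⁻¹ ∙ U ≈ 𝟙
  ∙-inverseˡ ⟪ mat a b c d , p ⟫ =
    inj₁ (mat-≡ (trans (adj-l₁ a b c d) p) (adj-l₂ b d) (adj-l₃ a c) (trans (adj-l₄ a b c d) p))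

  ∙-inverseʳ : ∀ U → U ∙ U ⁻¹ ≈ 𝟙
  ∙-inverseʳ ⟪ mat a b c d , p ⟫ =
    inj₁ (mat-≡ (trans (adj-r₁ a b c d) p) (adj-r₂ a b) (adj-r₃ c d) (trans (adj-r₄ a b c d) p))

  ⁻¹-cong : ∀ {U V} → U ≈ V → U ⁻¹ ≈ V ⁻¹
  ⁻¹-cong (inj₁ p) = inj₁ (cong adj p)
  ⁻¹-cong (inj₂ p) = inj₂ (cong adj p)

PSL₂ℤ : Group 0ℓ 0ℓ
PSL₂ℤ = record
  { Carrier = SL₂ ; _≈_ = _≈_ ; _∙_ = _∙_ ; ε = 𝟙 ; _⁻¹ = _⁻¹
  ; isGroup = record
    { isMonoid = record
      { isSemigroup = record
        { isMagma = record
          { isEquivalence = record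
            { refl  = inj₁ refl
            ; sym   = λ {U} {V} → ≈-sym {U} {V}
            ; trans = λ {U} {V} {W} → ≈-trans {U} {V} {W}
            }
          ; ∙-cong = λ {U} {U′} {V} {V′} → ∙-cong {U} {U′} {V} {V′}
          }
        ; assoc = ∙-assoc
        }
      ; identity = ∙-identityˡ , ∙-identityʳ
      }
    ; inverse = ∙-inverseˡ , ∙-inverseʳ
    ; ⁻¹-cong = λ {U} {V} → ⁻¹-cong {U} {V}
    }
  }

module Powers {c ℓ} (G : Group c ℓ) where
  open Group G renaming (_≈_ to _≈ᴳ_; _∙_ to _∙ᴳ_; _⁻¹ to _⁻¹ᴳ; sym to symᴳ; trans to transᴳ; refl to reflᴳ)
  open import Algebra.Properties.Group G using (⁻¹-involutive; ⁻¹-anti-homo-∙)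
  open import Relation.Binary.Reasoning.Setoid (Group.setoid G)

  infixr 8 _^ℕ_ _^_

  _^ℕ_ : Carrier → ℕ → Carrier
  x ^ℕ zero  = ε
  x ^ℕ suc n = x ∙ᴳ x ^ℕ n

  _^_ : Carrier → ℤ → Carrier
  x ^ (+ n)    = x ^ℕ n
  x ^ -[1+ n ] = (x ⁻¹ᴳ) ^ℕ suc n

  private
    ^-suc : ∀ x k → x ^ sucℤ k ≈ᴳ x ∙ᴳ x ^ k
    ^-suc x (+ n)           = reflᴳ
    ^-suc x -[1+ n ]        = begin
      x ^ sucℤ -[1+ n ]                 ≈⟨ lemma n ⟩
      (x ⁻¹ᴳ) ^ℕ n                      ≈⟨ identityˡ _ ⟨
      ε ∙ᴳ (x ⁻¹ᴳ) ^ℕ n                 ≈⟨ ∙-congʳ (inverseʳ x) ⟨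
      (x ∙ᴳ x ⁻¹ᴳ) ∙ᴳ (x ⁻¹ᴳ) ^ℕ n      ≈⟨ assoc _ _ _ ⟩
      x ∙ᴳ (x ⁻¹ᴳ ∙ᴳ (x ⁻¹ᴳ) ^ℕ n)      ∎
      where
      lemma : ∀ n → x ^ sucℤ -[1+ n ] ≈ᴳ (x ⁻¹ᴳ) ^ℕ n
      lemma zero    = reflᴳ
      lemma (suc n) = reflᴳ

    ^-pred : ∀ x k → x ^ predℤ k ≈ᴳ x ⁻¹ᴳ ∙ᴳ x ^ k
    ^-pred x k = begin
      x ^ predℤ k                          ≈⟨ identityˡ _ ⟨
      ε ∙ᴳ x ^ predℤ k                     ≈⟨ ∙-congʳ (inverseˡ x) ⟨
      (x ⁻¹ᴳ ∙ᴳ x) ∙ᴳ x ^ predℤ k          ≈⟨ assoc _ _ _ ⟩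
      x ⁻¹ᴳ ∙ᴳ (x ∙ᴳ x ^ predℤ k)          ≈⟨ ∙-congˡ (^-suc x (predℤ k)) ⟨
      x ⁻¹ᴳ ∙ᴳ x ^ sucℤ (predℤ k)          ≡⟨ cong (λ j → x ⁻¹ᴳ ∙ᴳ x ^ j) (ℤₚ.suc-pred k) ⟩
      x ⁻¹ᴳ ∙ᴳ x ^ k                       ∎

  ^-+ : ∀ x j k → x ^ (j + k) ≈ᴳ x ^ j ∙ᴳ x ^ k
  ^-+ x (+ zero) k = begin
    x ^ (0ℤ + k)   ≡⟨ cong (x ^_) (ℤₚ.+-identityˡ k) ⟩
    x ^ k          ≈⟨ identityˡ _ ⟨
    ε ∙ᴳ x ^ k     ∎
  ^-+ x (+ suc n) k = begin
    x ^ (+ suc n + k)              ≡⟨ cong (x ^_) (ℤₚ.+-assoc 1ℤ (+ n) k) ⟩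
    x ^ sucℤ (+ n + k)             ≈⟨ ^-suc x (+ n + k) ⟩
    x ∙ᴳ x ^ (+ n + k)             ≈⟨ ∙-congˡ (^-+ x (+ n) k) ⟩
    x ∙ᴳ (x ^ℕ n ∙ᴳ x ^ k)         ≈⟨ assoc _ _ _ ⟨
    (x ∙ᴳ x ^ℕ n) ∙ᴳ x ^ k         ∎
  ^-+ x -[1+ zero ] k = begin
    x ^ predℤ k                    ≈⟨ ^-pred x k ⟩
    x ⁻¹ᴳ ∙ᴳ x ^ k                 ≈⟨ ∙-congʳ (identityʳ _) ⟨
    (x ⁻¹ᴳ ∙ᴳ ε) ∙ᴳ x ^ k          ∎
  ^-+ x -[1+ suc n ] k = begin
    x ^ (-[1+ suc n ] + k)                  ≡⟨ cong (x ^_) (ℤₚ.+-assoc -[1+ 0 ] -[1+ n ] k) ⟩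
    x ^ predℤ (-[1+ n ] + k)                ≈⟨ ^-pred x (-[1+ n ] + k) ⟩
    x ⁻¹ᴳ ∙ᴳ x ^ (-[1+ n ] + k)             ≈⟨ ∙-congˡ (^-+ x -[1+ n ] k) ⟩
    x ⁻¹ᴳ ∙ᴳ (x ^ -[1+ n ] ∙ᴳ x ^ k)        ≈⟨ assoc _ _ _ ⟨
    (x ⁻¹ᴳ ∙ᴳ x ^ -[1+ n ]) ∙ᴳ x ^ k        ∎

  ⟨_⟩\G : Carrier → Setoid c ℓ
  ⟨ x ⟩\G = record
    { Carrier       = Carrier
    ; _≈_           = λ u v → ∃[ k ] v ≈ᴳ x ^ k ∙ᴳ u
    ; isEquivalence = record
      { refl  = 0ℤ , symᴳ (identityˡ _)
      ; sym   = λ { {u} {v} (k , p) → - k , (begin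
          u                            ≈⟨ identityˡ u ⟨
          ε ∙ᴳ u                       ≡⟨ cong (λ j → x ^ j ∙ᴳ u) (ℤₚ.+-inverseˡ k) ⟨
          x ^ (- k + k) ∙ᴳ u           ≈⟨ ∙-congʳ (^-+ x (- k) k) ⟩
          (x ^ (- k) ∙ᴳ x ^ k) ∙ᴳ u    ≈⟨ assoc _ _ _ ⟩
          x ^ (- k) ∙ᴳ (x ^ k ∙ᴳ u)    ≈⟨ ∙-congˡ p ⟨
          x ^ (- k) ∙ᴳ v               ∎) }
      ; trans = λ { {u} {v} {w} (j , p) (k , q) → k + j , (begin
          w                            ≈⟨ q ⟩
          x ^ k ∙ᴳ v                   ≈⟨ ∙-congˡ p ⟩
          x ^ k ∙ᴳ (x ^ j ∙ᴳ u)        ≈⟨ assoc _ _ _ ⟨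
          (x ^ k ∙ᴳ x ^ j) ∙ᴳ u        ≈⟨ ∙-congʳ (^-+ x k j) ⟨
          x ^ (k + j) ∙ᴳ u             ∎) }
      }
    }

open Powers PSL₂ℤ public using (_^_; ⟨_⟩\G)

record Form : Set where
  constructor form
  field A B C : ℤ

open Form public using (A; B; C)

eval : Form → ℤ → ℤ → ℤ
eval (form A B C) x y = A * (x * x) + B * (x * y) + C * (y * y)

Δ : Form → ℤ
Δ (form A B C) = B * B - + 4 * (A * C)

infixr 7 _·_

_·_ : SL₂ → Form → Form
⟪ mat a b c d , _ ⟫ · form A B C = form
  (A * (a * a) + B * (a * c) + C * (c * c))
  (+ 2 * (A * (a * b)) + B * (a * d + b * c) + + 2 * (C * (c * d)))
  (A * (b * b) + B * (b * d) + C * (d * d))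

private
  eval-solve : ∀ a b c d A B C x y →
    (A * (a * a) + B * (a * c) + C * (c * c)) * (x * x)
    + (+ 2 * (A * (a * b)) + B * (a * d + b * c) + + 2 * (C * (c * d))) * (x * y)
    + (A * (b * b) + B * (b * d) + C * (d * d)) * (y * y)
    ≡ A * ((a * x + b * y) * (a * x + b * y)) + B * ((a * x + b * y) * (c * x + d * y))
      + C * ((c * x + d * y) * (c * x + d * y))
  eval-solve = solve-∀

-- The coefficients above are those of f(U(x , y)ᵗ).
eval-· : ∀ U f x y →
  eval (U · f) x y ≡ eval f (SL₂.a U * x + SL₂.b U * y) (SL₂.c U * x + SL₂.d U * y)
eval-· ⟪ mat a b c d , _ ⟫ (form A B C) x y = eval-solve a b c d A B C x y

Indefinite : Form → Set
Indefinite f = 0ℤ < Δ f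

NonSquare : ℤ → Set
NonSquare D = ¬ (∃[ n ] n * n ≡ D)

_∈[_] : Form → Form → Set
g ∈[ f ] = ∃[ U ] g ≡ U · f

-- The cut defined by the real number √D, for D > 0.
infix 4 _<√_ √_<_

_<√_ : ℤ → ℤ → Set
x <√ D = x < 0ℤ ⊎ x * x < D

√_<_ : ℤ → ℤ → Set
√ D < x = 0ℤ ≤ x × D < x * x

-- |√Δ - 2|A|| < B < √Δ, where the first inequality is written as the pair
-- √Δ < B + 2|A| and 2|A| - B < √Δ.
Reduced : Form → Set
Reduced f = √ Δ f < (B f + + 2 * + ∣ A f ∣)
          × + 2 * + ∣ A f ∣ - B f <√ Δ f
          × B f <√ Δ f

sgn : ℤ → ℤ
sgn +0       = 0ℤ
sgn +[1+ _ ] = 1ℤ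
sgn -[1+ _ ] = - 1ℤ

-- M is the distinguished generator of Aut(f), with entries p = a, q = b, r = c, s = d; the last
-- five fields say that sgn(p + s)(r , s - p , - q) is (m / n) f for some rational m / n > 0.
record IsM (f : Form) (M : SL₂) : Set where
  open SL₂ M renaming (a to p; b to q; c to r; d to s)
  field
    fixes     : M · f ≡ f
    generates : ∀ U → U · f ≡ f → ∃[ k ] U ≈ M ^ k
    m n       : ℕ
    {{m≢0}}   : NonZero m
    {{n≢0}}   : NonZero n
    multiple  : + n * (sgn (p + s) * r)       ≡ + m * A f
              × + n * (sgn (p + s) * (s - p)) ≡ + m * B f
              × + n * (sgn (p + s) * - q)     ≡ + m * C f

-- The edge {W} of the bipartite Farey tree is represented by W, its ⊗-end being {W, WS} and
-- its •-end {W, WR, WR²}.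
S R : SL₂
S = ⟪ mat 0ℤ (- 1ℤ) 1ℤ 0ℤ , refl ⟫
R = ⟪ mat 1ℤ (- 1ℤ) 1ℤ 0ℤ , refl ⟫

-- The edges {V} and {W} are distinct and meet at a ⊗-vertex.
Meet⊗ : SL₂ → SL₂ → Set
Meet⊗ V W = (W ≈ V ⊎ W ≈ V ∙ S) × V ≉ W

-- The edges {V} and {W} are distinct and meet at a •-vertex.
Meet• : SL₂ → SL₂ → Set
Meet• V W = (W ≈ V ⊎ W ≈ V ∙ R ⊎ W ≈ V ∙ (R ∙ R)) × V ≉ W

-- The axis of M in the tree, directed by the translation direction of M: a bi-infinite path
-- without backtracking which M translates forwards.  The path visits its •-vertices in the
-- order …, v (-1), v 0, v 1, …; it enters v n along the edge into n and leaves it along the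
-- edge from n, and between v n and v (n + 1) it passes through one ⊗-vertex.
record Axis (M : SL₂) : Set where
  field
    into from : ℤ → SL₂
    at•       : ∀ n → Meet• (into n) (from n)
    at⊗       : ∀ n → Meet⊗ (from n) (into (sucℤ n))
    ℓ         : ℕ
    {{ℓ≢0}}   : NonZero ℓ
    translate : ∀ n → M ∙ into n ≈ into (n + + ℓ) × M ∙ from n ≈ from (n + + ℓ)

-- The ⊗-end of the edge {W} is the point W(i) = ((ac + bd) + i) / (c² + d²) of the upper half
-- plane.  It is represented by the triple (ac + bd , 1 , c² + d²), standing for
-- (x N , y N , N) with N > 0.
record Point : Set where
  constructor point
  field X Y N : ℤ

⊗-end : SL₂ → Point
⊗-end ⟪ mat a b c d , _ ⟫ = point (a * c + b * d) 1ℤ (c * c + d * d)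

-- As N > 0, this determinant has the sign of the signed area of the triangle.
orientation : Point → Point → Point → ℤ
orientation (point X₁ Y₁ N₁) (point X₂ Y₂ N₂) (point X₃ Y₃ N₃) =
  X₁ * (Y₂ * N₃ - Y₃ * N₂) - Y₁ * (X₂ * N₃ - X₃ * N₂) + N₁ * (X₂ * Y₃ - X₃ * Y₂)

-- For the three edges at a •-vertex v: they leave v in the counterclockwise order U, V, W.
-- They are geodesic radii, of equal length, of a hyperbolic circle centred at v, which is
-- also a Euclidean circle around v; so their cyclic order is that of their ⊗-ends.
Counterclockwise : SL₂ → SL₂ → SL₂ → Set
Counterclockwise U V W = 0ℤ < orientation (⊗-end U) (⊗-end V) (⊗-end W)

module _ {M : SL₂} (γ : Axis M) where
  open Axis γ

  -- {W} is the first edge of the branch growing from v n.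
  Branch : ℤ → SL₂ → Set
  Branch n W = Meet• (into n) W × Meet• (from n) W

  -- The inner boundary component is to the left of the directed spine: a branch goes there
  -- when it leaves the axis to its left, that is when the incoming edge, the outgoing edge
  -- and the branch follow each other counterclockwise.
  ToInner : ℤ → Set
  ToInner n = ∃[ W ] Branch n W × Counterclockwise (into n) (from n) W

  ToOuter : ℤ → Set
  ToOuter n = ∃[ W ] Branch n W × Counterclockwise (from n) (into n) W

  -- {W} joins some v n with branch going to the inner boundary to a ⊗-vertex whose other
  -- neighbour on the axis, v (n - 1) or v (n + 1), has its branch going to the outer boundary.
  ReducedOn : SL₂ → Set
  ReducedOn W = ∃[ n ] ToInner n × ( W ≈ into n × ToOuter (predℤ n)
                                   ⊎ W ≈ from n × ToOuter (sucℤ n))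

ÇarkEdges : SL₂ → Setoid 0ℓ 0ℓ
ÇarkEdges M = ⟨ M ⟩\G

-- The spine being the image of the axis, an edge of the çark is reduced when it has a lift
-- to the tree which is reduced on the axis.
IsReducedEdge : (M W : SL₂) → Set
IsReducedEdge M W = ∃[ V ] Setoid._≈_ (ÇarkEdges M) W V × Σ[ γ ∈ Axis M ] ReducedOn γ V

ReducedEdges : SL₂ → Setoid 0ℓ 0ℓ
ReducedEdges M = On.setoid {B = Σ SL₂ (IsReducedEdge M)} (ÇarkEdges M) proj₁

ReducedForms : Form → Setoid 0ℓ 0ℓ
ReducedForms f = On.setoid {B = Σ[ g ∈ Form ] g ∈[ f ] × Reduced g} (setoid Form) proj₁

-- Gauss reduction of (A , B , C) amounts to AC < 0 and B > |A + C|.  Put L = (1 0; 1 1) and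
-- T = (1 1; 0 1).  Along the axis, V = into n becomes into (n + 1) = VL when the branch at v n goes
-- to the inner boundary component and VT when it goes to the outer one.  So V⁻¹MV is, up to sign, a
-- word in L and T with one letter for each •-vertex of a period, and its fixed form is a positive
-- multiple of V · f.  For W = into n to be a reduced edge the word has to have the shape L⋯T, and a
-- nonnegative matrix LY = ZT has a fixed form with A > 0 > C and B > |A + C|; conversely, if V · f
-- is such a form then V⁻¹MV = LYT with Y nonnegative of determinant 1, hence a word, and repeating
-- LYT periodically gives the axis.  For W = from n the same holds with V = WS, the shape T⋯L and
-- A < 0 < C.
module Submission where

open import Defs
open import Data.Product using (Σ-syntax; proj₁)
open import Function.Bundles using (Bijection)
open import Relation.Binary.Bundles using (Setoid)
open import Relation.Binary.PropositionalEquality using (_≡_)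
open import Algebra.Bundles using (Group)
open import Data.Fin using (zero; suc; toℕ; fromℕ; fromℕ<)
open import Data.Fin.Properties using (fromℕ<-cong; fromℕ<-toℕ; toℕ<n; toℕ-fromℕ)
open import Data.Integer using (ℤ; +_; -[1+_]; +[1+_]; +0; 0ℤ; 1ℤ; _+_; _*_; _-_; -_; ∣_∣; _<_; _≤_; +<+; +≤+)
  renaming (suc to sucℤ; pred to predℤ)
open import Data.Integer.DivMod using (_%ℕ_; _/ℕ_; n%ℕd<d; a≡a%ℕn+[a/ℕn]*n)
import Data.Integer.Properties as ℤₚ
open import Data.Integer.Tactic.RingSolver using (solve-∀)
open import Data.Nat as ℕ using (ℕ; zero; suc; NonZero; s≤s; z≤n)
import Data.Nat.DivMod as ℕ
import Data.Nat.Divisibility as ℕ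
import Data.Nat.Properties as ℕ
import Data.Nat.Tactic.RingSolver as ℕ-Solver
open import Data.Product using (∃-syntax; _×_; _,_; proj₂)
open import Data.Sum using (_⊎_; inj₁; inj₂)
open import Data.Vec using (Vec; []; _∷_; _∷ʳ_; lookup)
open import Relation.Binary.PropositionalEquality using (refl; sym; trans; cong; cong₂; subst; subst₂;
  module ≡-Reasoning)
open import Relation.Nullary using (contradiction; ¬_)

open Powers PSL₂ℤ using (_^ℕ_)
open SL₂ using (matrix)

-- Periodic walks in a group

-- An element of PSL₂(ℤ) determines its matrix only up to sign, while balance is a statement about
-- signs. The trace restores the sign: `orientedForm` carries the factor sgn(p + s), so it is well
-- defined on PSL₂(ℤ) and equivariant under conjugation. A product of steps has positive trace, so
-- two factorisations of one period that agree in PSL₂(ℤ) agree as matrices, and their entries can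
-- be compared.
--
-- Gauss reducedness sees only the two letters next to the ⊗-vertex of the edge, which are the first
-- and the last letter of the period read from there. Of the remaining letters only the signs of the
-- entries of their product matter. The converse has to recover the whole word from its matrix, and
-- this is a Euclidean algorithm on the rows.
--
-- `IsReducedEdge` asks for some axis. Accordingly the forward direction treats an arbitrary axis of
-- M, and the converse constructs one.

ℤ-ind : ∀ {p} (P : ℤ → Set p) → P 0ℤ → (∀ n → P n → P (sucℤ n)) → (∀ n → P n → P (predℤ n)) →
        ∀ n → P n
ℤ-ind P z s p (+ zero)       = z
ℤ-ind P z s p (+ suc n)      = s (+ n) (ℤ-ind P z s p (+ n))
ℤ-ind P z s p -[1+ zero ]    = p 0ℤ z
ℤ-ind P z s p -[1+ suc n ]   = p -[1+ n ] (ℤ-ind P z s p -[1+ n ])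

+-sucʳ : ∀ n k → n + (1ℤ + k) ≡ 1ℤ + (n + k)
+-sucʳ = solve-∀

+-sucˡ : ∀ n k → n + (1ℤ + k) ≡ (1ℤ + n) + k
+-sucˡ = solve-∀

module GroupLemmas {c ℓ} (G : Group c ℓ) where
  open Group G renaming (_≈_ to _≈ᴳ_; _∙_ to _∙ᴳ_; _⁻¹ to _⁻¹ᴳ; refl to ≈-refl; sym to ≈-sym; trans to ≈-trans)
  open import Relation.Binary.Reasoning.Setoid setoid
  open import Algebra.Properties.Group G using (∙-cancelˡ; //-rightDividesˡ; //-rightDividesʳ)

  compose : ∀ {x y z} a b {c} → y ≈ᴳ x ∙ᴳ a → z ≈ᴳ y ∙ᴳ b → a ∙ᴳ b ≈ᴳ c → z ≈ᴳ x ∙ᴳ c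
  compose {x} {y} {z} a b {c} y≈xa z≈yb ab≈c = begin
    z              ≈⟨ z≈yb ⟩
    y ∙ᴳ b         ≈⟨ ∙-congʳ y≈xa ⟩
    (x ∙ᴳ a) ∙ᴳ b  ≈⟨ assoc x a b ⟩
    x ∙ᴳ (a ∙ᴳ b)  ≈⟨ ∙-congˡ ab≈c ⟩
    x ∙ᴳ c         ∎

  relate : ∀ {x y z} a b c → y ≈ᴳ x ∙ᴳ a → z ≈ᴳ x ∙ᴳ b → b ≈ᴳ a ∙ᴳ c → z ≈ᴳ y ∙ᴳ c
  relate {x} {y} {z} a b c y≈xa z≈xb b≈ac = begin
    z              ≈⟨ z≈xb ⟩
    x ∙ᴳ b         ≈⟨ ∙-congˡ b≈ac ⟩
    x ∙ᴳ (a ∙ᴳ c)  ≈⟨ assoc x a c ⟨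
    (x ∙ᴳ a) ∙ᴳ c  ≈⟨ ∙-congʳ y≈xa ⟨
    y ∙ᴳ c         ∎

  separate : ∀ {x y z} a b → y ≈ᴳ x ∙ᴳ a → z ≈ᴳ x ∙ᴳ b → ¬ (a ≈ᴳ b) → ¬ (y ≈ᴳ z)
  separate {x} a b y≈xa z≈xb a≉b y≈z =
    a≉b (∙-cancelˡ x a b (≈-trans (≈-sym y≈xa) (≈-trans y≈z z≈xb)))

  extend : ∀ {m x y} a → m ∙ᴳ x ≈ᴳ y → m ∙ᴳ (x ∙ᴳ a) ≈ᴳ y ∙ᴳ a
  extend {m} {x} a mx≈y = ≈-trans (≈-sym (assoc m x a)) (∙-congʳ mx≈y)

  undo : ∀ x {a} → a ∙ᴳ a ≈ᴳ ε → (x ∙ᴳ a) ∙ᴳ a ≈ᴳ x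
  undo x {a} aa≈ε = ≈-trans (assoc x a a) (≈-trans (∙-congˡ aa≈ε) (identityʳ x))

  moves : ∀ {x y} a → y ≈ᴳ x ∙ᴳ a → ¬ (ε ≈ᴳ a) → ¬ (x ≈ᴳ y)
  moves {x} a y≈xa = separate ε a (≈-sym (identityʳ x)) y≈xa

  module _ (v s : ℤ → Carrier) (step : ∀ n → v (sucℤ n) ≈ᴳ v n ∙ᴳ s n) where

    module _ {p} (P : Carrier → Set p) (P-ε : P ε) (P-∙ : ∀ {y} n → P y → P (y ∙ᴳ s n)) where

      -- The product of the steps is kept abstract. Only a property stable under right
      -- multiplication by steps is carried along; it is later instantiated with `Positive`.
      travel : ∀ n k → ∃[ y ] P y × v (n + + k) ≈ᴳ v n ∙ᴳ y
      travel n zero    = ε , P-ε , (begin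
        v (n + 0ℤ)  ≡⟨ cong v (ℤₚ.+-identityʳ n) ⟩
        v n         ≈⟨ identityʳ (v n) ⟨
        v n ∙ᴳ ε    ∎)
      travel n (suc k) with y , Py , eq ← travel n k = y ∙ᴳ s (n + + k) , P-∙ (n + + k) Py , (begin
        v (n + + suc k)             ≡⟨ cong v (+-sucʳ n (+ k)) ⟩
        v (sucℤ (n + + k))          ≈⟨ step (n + + k) ⟩
        v (n + + k) ∙ᴳ s (n + + k)  ≈⟨ ∙-congʳ eq ⟩
        (v n ∙ᴳ y) ∙ᴳ s (n + + k)   ≈⟨ assoc (v n) y (s (n + + k)) ⟩
        v n ∙ᴳ (y ∙ᴳ s (n + + k))   ∎)

      module _ (m : Carrier) (k : ℕ) (translate : ∀ n → m ∙ᴳ v n ≈ᴳ v (n + + suc k)) where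

        period-headed : ∀ n → ∃[ y ] P y × m ∙ᴳ v n ≈ᴳ v n ∙ᴳ (s n ∙ᴳ y)
        period-headed n with y , Py , eq ← travel (sucℤ n) k = y , Py , (begin
          m ∙ᴳ v n           ≈⟨ translate n ⟩
          v (n + + suc k)    ≡⟨ cong v (+-sucˡ n (+ k)) ⟩
          v (sucℤ n + + k)   ≈⟨ eq ⟩
          v (sucℤ n) ∙ᴳ y    ≈⟨ ∙-congʳ (step n) ⟩
          (v n ∙ᴳ s n) ∙ᴳ y  ≈⟨ assoc (v n) (s n) y ⟩
          v n ∙ᴳ (s n ∙ᴳ y)  ∎)

        -- `period-headed` at `sucℤ n` isolates the first letter of the same period. Together they
        -- expose the two letters on either side of the passage from v n to v (n + 1).
        period-tailed : ∀ n → ∃[ z ] P z × m ∙ᴳ v (sucℤ n) ≈ᴳ v (sucℤ n) ∙ᴳ (z ∙ᴳ s n)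
        period-tailed n with z , Pz , eq ← travel (sucℤ n) k = z , Pz , (begin
          m ∙ᴳ v (sucℤ n)           ≈⟨ ∙-congˡ (step n) ⟩
          m ∙ᴳ (v n ∙ᴳ s n)         ≈⟨ assoc m (v n) (s n) ⟨
          (m ∙ᴳ v n) ∙ᴳ s n         ≈⟨ ∙-congʳ (translate n) ⟩
          v (n + + suc k) ∙ᴳ s n    ≡⟨ cong (λ j → v j ∙ᴳ s n) (+-sucˡ n (+ k)) ⟩
          v (sucℤ n + + k) ∙ᴳ s n   ≈⟨ ∙-congʳ eq ⟩
          (v (sucℤ n) ∙ᴳ z) ∙ᴳ s n  ≈⟨ assoc (v (sucℤ n)) z (s n) ⟩
          v (sucℤ n) ∙ᴳ (z ∙ᴳ s n)  ∎)

  module Walk (s : ℤ → Carrier) (v₀ : Carrier) where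

    walk : ℤ → Carrier
    walk (+ zero)     = v₀
    walk (+ suc n)    = walk (+ n) ∙ᴳ s (+ n)
    walk -[1+ zero ]  = v₀ ∙ᴳ s -[1+ 0 ] ⁻¹ᴳ
    walk -[1+ suc n ] = walk -[1+ n ] ∙ᴳ s -[1+ suc n ] ⁻¹ᴳ

    walk-suc : ∀ n → walk (sucℤ n) ≈ᴳ walk n ∙ᴳ s n
    walk-suc (+ n)          = ≈-refl
    walk-suc -[1+ zero ]    = ≈-sym (//-rightDividesˡ (s -[1+ 0 ]) v₀)
    walk-suc -[1+ suc n ]   = ≈-sym (//-rightDividesˡ (s -[1+ suc n ]) (walk -[1+ n ]))

    walk-pred : ∀ n → walk (predℤ n) ≈ᴳ walk n ∙ᴳ s (predℤ n) ⁻¹ᴳ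
    walk-pred (+ suc n)   = ≈-sym (//-rightDividesʳ (s (+ n)) (walk (+ n)))
    walk-pred (+ zero)    = ≈-refl
    walk-pred -[1+ n ]    = ≈-refl

    module _ (m : Carrier) (k : ℤ) (periodic : ∀ n → s (n + k) ≡ s n) (base : m ∙ᴳ v₀ ≈ᴳ walk k) where

      -- Both sides follow the same steps because s has period k, so agreement at 0 spreads in both
      -- directions.
      walk-translate : ∀ n → m ∙ᴳ walk n ≈ᴳ walk (n + k)
      walk-translate = ℤ-ind _ zero-case suc-case pred-case
        where
        zero-case : m ∙ᴳ v₀ ≈ᴳ walk (0ℤ + k)
        zero-case = ≈-trans base (reflexive (cong walk (sym (ℤₚ.+-identityˡ k))))

        suc-case : ∀ n → m ∙ᴳ walk n ≈ᴳ walk (n + k) → m ∙ᴳ walk (sucℤ n) ≈ᴳ walk (sucℤ n + k)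
        suc-case n ih = begin
          m ∙ᴳ walk (sucℤ n)         ≈⟨ ∙-congˡ (walk-suc n) ⟩
          m ∙ᴳ (walk n ∙ᴳ s n)       ≈⟨ assoc m (walk n) (s n) ⟨
          (m ∙ᴳ walk n) ∙ᴳ s n       ≈⟨ ∙-congʳ ih ⟩
          walk (n + k) ∙ᴳ s n        ≡⟨ cong (walk (n + k) ∙ᴳ_) (periodic n) ⟨
          walk (n + k) ∙ᴳ s (n + k)  ≈⟨ walk-suc (n + k) ⟨
          walk (sucℤ (n + k))        ≡⟨ cong walk (ℤₚ.+-assoc 1ℤ n k) ⟨
          walk (sucℤ n + k)          ∎

        pred-case : ∀ n → m ∙ᴳ walk n ≈ᴳ walk (n + k) → m ∙ᴳ walk (predℤ n) ≈ᴳ walk (predℤ n + k)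
        pred-case n ih = begin
          m ∙ᴳ walk (predℤ n)                    ≈⟨ ∙-congˡ (walk-pred n) ⟩
          m ∙ᴳ (walk n ∙ᴳ s (predℤ n) ⁻¹ᴳ)       ≈⟨ assoc m (walk n) (s (predℤ n) ⁻¹ᴳ) ⟨
          (m ∙ᴳ walk n) ∙ᴳ s (predℤ n) ⁻¹ᴳ       ≈⟨ ∙-congʳ ih ⟩
          walk (n + k) ∙ᴳ s (predℤ n) ⁻¹ᴳ        ≡⟨ cong (λ x → walk (n + k) ∙ᴳ x ⁻¹ᴳ) (periodic (predℤ n)) ⟨
          walk (n + k) ∙ᴳ s (predℤ n + k) ⁻¹ᴳ    ≡⟨ cong (λ j → walk (n + k) ∙ᴳ s j ⁻¹ᴳ) shift ⟩
          walk (n + k) ∙ᴳ s (predℤ (n + k)) ⁻¹ᴳ  ≈⟨ walk-pred (n + k) ⟨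
          walk (predℤ (n + k))                   ≡⟨ cong walk shift ⟨
          walk (predℤ n + k)                     ∎
          where
          shift : predℤ n + k ≡ predℤ (n + k)
          shift = ℤₚ.+-assoc -[1+ 0 ] n k

-- Periodic sequences indexed by the integers

%ℕ-unique-≤ : ∀ {r r′ q q′} d → r′ ℕ.< d → r ℕ.≤ r′ → + r + q * + d ≡ + r′ + q′ * + d → r ≡ r′
%ℕ-unique-≤ {r} {q = q} {q′} d r′<d r≤r′ eq with k , refl ← ℕ.m≤n⇒∃[o]m+o≡n r≤r′ = helper k r′<d multiple
  where
  solve-k : ∀ r k a b → k ≡ ((r + k) + b) - (r + b)
  solve-k = solve-∀

  cancel-r : ∀ r x y z → (r + x * z) - (r + y * z) ≡ (x - y) * z
  cancel-r = solve-∀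

  multiple : k ≡ ∣ q - q′ ∣ ℕ.* d
  multiple = begin
    k                                                ≡⟨⟩
    ∣ + k ∣                                          ≡⟨ cong ∣_∣ (solve-k (+ r) (+ k) 0ℤ (q′ * + d)) ⟩
    ∣ (+ (r ℕ.+ k) + q′ * + d) - (+ r + q′ * + d) ∣  ≡⟨ cong (λ x → ∣ x - (+ r + q′ * + d) ∣) eq ⟨
    ∣ (+ r + q * + d) - (+ r + q′ * + d) ∣           ≡⟨ cong ∣_∣ (cancel-r (+ r) q q′ (+ d)) ⟩
    ∣ (q - q′) * + d ∣                               ≡⟨ ℤₚ.abs-* (q - q′) (+ d) ⟩
    ∣ q - q′ ∣ ℕ.* d                                 ∎
    where open ≡-Reasoning

  helper : ∀ k → r ℕ.+ k ℕ.< d → k ≡ ∣ q - q′ ∣ ℕ.* d → r ≡ r ℕ.+ k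
  helper zero    _    _  = sym (ℕ.+-identityʳ r)
  -- A positive difference of the remainders would be a multiple of d smaller than d.
  helper (suc k) r+k<d eq =
    contradiction (ℕ.divides ∣ q - q′ ∣ eq) (ℕ.>⇒∤ (ℕ.≤-<-trans (ℕ.m≤n+m (suc k) r) r+k<d))

%ℕ-unique : ∀ {r r′ q q′} d → r ℕ.< d → r′ ℕ.< d → + r + q * + d ≡ + r′ + q′ * + d → r ≡ r′
%ℕ-unique {r} {r′} {q} {q′} d r<d r′<d eq with ℕ.≤-total r r′
... | inj₁ r≤r′ = %ℕ-unique-≤ {q = q} {q′} d r′<d r≤r′ eq
... | inj₂ r′≤r = sym (%ℕ-unique-≤ {q = q′} {q} d r<d r′≤r (sym eq))

[n+d]%ℕd≡n%ℕd : ∀ n d .{{_ : NonZero d}} → (n + + d) %ℕ d ≡ n %ℕ d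
[n+d]%ℕd≡n%ℕd n d = %ℕ-unique {q = (n + + d) /ℕ d} {n /ℕ d + 1ℤ} d (n%ℕd<d (n + + d) d) (n%ℕd<d n d) (begin
  + ((n + + d) %ℕ d) + (n + + d) /ℕ d * + d  ≡⟨ a≡a%ℕn+[a/ℕn]*n (n + + d) d ⟨
  n + + d                                    ≡⟨ cong (_+ + d) (a≡a%ℕn+[a/ℕn]*n n d) ⟩
  + (n %ℕ d) + n /ℕ d * + d + + d            ≡⟨ carry (+ (n %ℕ d)) (n /ℕ d) (+ d) ⟩
  + (n %ℕ d) + (n /ℕ d + 1ℤ) * + d           ∎)
  where
  open ≡-Reasoning
  carry : ∀ r q z → r + q * z + z ≡ r + (q + 1ℤ) * z
  carry = solve-∀

module _ {a} {A : Set a} where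

  cyclic : ∀ {k} → Vec A (suc k) → ℤ → A
  cyclic {k} u n = lookup u (fromℕ< (n%ℕd<d n (suc k)))

  cyclic-periodic : ∀ {k} (u : Vec A (suc k)) n → cyclic u (n + + suc k) ≡ cyclic u n
  cyclic-periodic {k} u n = cong (lookup u) (fromℕ<-cong _ _ ([n+d]%ℕd≡n%ℕd n (suc k)) _ _)

  cyclic-toℕ : ∀ {k} (u : Vec A (suc k)) i → cyclic u (+ toℕ i) ≡ lookup u i
  cyclic-toℕ u i = cong (lookup u)
    (trans (fromℕ<-cong _ _ (ℕ.m<n⇒m%n≡m (toℕ<n i)) _ (toℕ<n i)) (fromℕ<-toℕ i _))

  lookup-fromℕ-∷ʳ : ∀ {k} (u : Vec A k) x → lookup (u ∷ʳ x) (fromℕ k) ≡ x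
  lookup-fromℕ-∷ʳ []      x = refl
  lookup-fromℕ-∷ʳ (_ ∷ u) x = lookup-fromℕ-∷ʳ u x

  -- Index -1 is congruent to k modulo the length k + 1. This is the letter with which the repeated
  -- word arrives at its starting point.
  cyclic-last : ∀ {k} (u : Vec A k) x → cyclic (u ∷ʳ x) -[1+ 0 ] ≡ x
  cyclic-last {k} u x = begin
    cyclic (u ∷ʳ x) -[1+ 0 ]           ≡⟨ cyclic-periodic (u ∷ʳ x) -[1+ 0 ] ⟨
    cyclic (u ∷ʳ x) (+ k)              ≡⟨ cong (λ j → cyclic (u ∷ʳ x) (+ j)) (toℕ-fromℕ k) ⟨
    cyclic (u ∷ʳ x) (+ toℕ (fromℕ k))  ≡⟨ cyclic-toℕ (u ∷ʳ x) (fromℕ k) ⟩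
    lookup (u ∷ʳ x) (fromℕ k)          ≡⟨ lookup-fromℕ-∷ʳ u x ⟩
    x                                  ∎
    where open ≡-Reasoning

module Words {c ℓ} (G : Group c ℓ) {a} {A : Set a} (t : A → Group.Carrier G) where
  open Group G renaming (_≈_ to _≈ᴳ_; _∙_ to _∙ᴳ_; _⁻¹ to _⁻¹ᴳ; refl to ≈-refl; sym to ≈-sym; trans to ≈-trans)
  open import Relation.Binary.Reasoning.Setoid setoid
  open GroupLemmas G

  word : ∀ {k} → Vec A k → Carrier
  word []      = ε
  word (x ∷ u) = t x ∙ᴳ word u

  word-∷ʳ : ∀ {k} (u : Vec A k) x → word (u ∷ʳ x) ≈ᴳ word u ∙ᴳ t x
  word-∷ʳ []      x = ≈-trans (identityʳ (t x)) (≈-sym (identityˡ (t x)))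
  word-∷ʳ (y ∷ u) x = ≈-trans (∙-congˡ (word-∷ʳ u x)) (≈-sym (assoc (t y) (word u) (t x)))

  module _ (s : ℤ → Carrier) (v₀ : Carrier) where
    open Walk s v₀

    -- The starting index j is arbitrary so that the induction can read the tail of the word one
    -- position later.
    walk-word : ∀ j {k} (u : Vec A k) → (∀ i → s (+ (j ℕ.+ toℕ i)) ≡ t (lookup u i)) →
                walk (+ (j ℕ.+ k)) ≈ᴳ walk (+ j) ∙ᴳ word u
    walk-word j []      _ = begin
      walk (+ (j ℕ.+ 0))  ≡⟨ cong (λ i → walk (+ i)) (ℕ.+-identityʳ j) ⟩
      walk (+ j)          ≈⟨ identityʳ (walk (+ j)) ⟨
      walk (+ j) ∙ᴳ ε     ∎
    walk-word j {suc k} (x ∷ u) spells = begin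
      walk (+ (j ℕ.+ suc k))             ≡⟨ cong (λ i → walk (+ i)) (ℕ.+-suc j k) ⟩
      walk (+ (suc j ℕ.+ k))             ≈⟨ walk-word (suc j) u tail ⟩
      (walk (+ j) ∙ᴳ s (+ j)) ∙ᴳ word u  ≡⟨ cong (λ y → (walk (+ j) ∙ᴳ y) ∙ᴳ word u) head ⟩
      (walk (+ j) ∙ᴳ t x) ∙ᴳ word u      ≈⟨ assoc (walk (+ j)) (t x) (word u) ⟩
      walk (+ j) ∙ᴳ (t x ∙ᴳ word u)      ∎
      where
      head : s (+ j) ≡ t x
      head = trans (cong (λ i → s (+ i)) (sym (ℕ.+-identityʳ j))) (spells zero)
      tail : ∀ i → s (+ (suc j ℕ.+ toℕ i)) ≡ t (lookup u i)
      tail i = trans (cong (λ n → s (+ n)) (sym (ℕ.+-suc j (toℕ i)))) (spells (suc i))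

  walk-along-word : ∀ (m v₀ : Carrier) {k} (u : Vec A (suc k)) → m ∙ᴳ v₀ ≈ᴳ v₀ ∙ᴳ word u →
                    ∀ n → let open Walk (λ n → t (cyclic u n)) v₀ in m ∙ᴳ walk n ≈ᴳ walk (n + + suc k)
  walk-along-word m v₀ {k} u eq = walk-translate m (+ suc k)
    (λ n → cong t (cyclic-periodic u n))
    (≈-trans eq (≈-sym (walk-word _ v₀ 0 u (λ i → cong t (cyclic-toℕ u i)))))
    where open Walk (λ n → t (cyclic u n)) v₀

-- Words in the matrices (1 0; 1 1) and (1 1; 0 1)

mat-cong : ∀ {a b c d a′ b′ c′ d′} → a ≡ a′ → b ≡ b′ → c ≡ c′ → d ≡ d′ →
           mat a b c d ≡ mat a′ b′ c′ d′
mat-cong refl refl refl refl = refl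

-- The boundary component to which a branch of the axis goes.
data Side : Set where
  inner outer : Side

-- The axis turns right, by R², at a branch to the inner component and left, by R, at a branch to
-- the outer one; S then carries it across the next ⊗-vertex.  Up to sign these are R²S and RS.
step : Side → SL₂
step inner = ⟪ mat 1ℤ 0ℤ 1ℤ 1ℤ , refl ⟫
step outer = ⟪ mat 1ℤ 1ℤ 0ℤ 1ℤ , refl ⟫

open import Algebra.Properties.Group PSL₂ℤ
  using (∙-cancelʳ; \\-leftDividesˡ; \\-leftDividesʳ; //-rightDividesˡ)
open GroupLemmas PSL₂ℤ
open Words PSL₂ℤ step
module PSL = Group PSL₂ℤ

private
  1x+0y : ∀ x y → 1ℤ * x + 0ℤ * y ≡ x
  1x+0y = solve-∀

  0x+1y : ∀ x y → 0ℤ * x + 1ℤ * y ≡ y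
  0x+1y = solve-∀

  1x+1y : ∀ x y → 1ℤ * x + 1ℤ * y ≡ x + y
  1x+1y = solve-∀

  x1+y0 : ∀ x y → x * 1ℤ + y * 0ℤ ≡ x
  x1+y0 = solve-∀

  x0+y1 : ∀ x y → x * 0ℤ + y * 1ℤ ≡ y
  x0+y1 = solve-∀

  x1+y1 : ∀ x y → x * 1ℤ + y * 1ℤ ≡ x + y
  x1+y1 = solve-∀

inner-∙ₘ : ∀ x y z w → matrix (step inner) ∙ₘ mat x y z w ≡ mat x y (x + z) (y + w)
inner-∙ₘ x y z w = mat-cong (1x+0y x z) (1x+0y y w) (1x+1y x z) (1x+1y y w)

outer-∙ₘ : ∀ x y z w → matrix (step outer) ∙ₘ mat x y z w ≡ mat (x + z) (y + w) z w
outer-∙ₘ x y z w = mat-cong (1x+1y x z) (1x+1y y w) (0x+1y x z) (0x+1y y w)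

∙ₘ-inner : ∀ x y z w → mat x y z w ∙ₘ matrix (step inner) ≡ mat (x + y) y (z + w) w
∙ₘ-inner x y z w = mat-cong (x1+y1 x y) (x0+y1 x y) (x1+y1 z w) (x0+y1 z w)

∙ₘ-outer : ∀ x y z w → mat x y z w ∙ₘ matrix (step outer) ≡ mat x (x + y) z (z + w)
∙ₘ-outer x y z w = mat-cong (x1+y0 x y) (x1+y1 x y) (x1+y0 z w) (x1+y1 z w)

IsWord : ℕ → ℕ → ℕ → ℕ → Set
IsWord x y z w = ∃[ k ] Σ[ u ∈ Vec Side k ] matrix (word u) ≡ mat (+ x) (+ y) (+ z) (+ w)

inner-IsWord : ∀ {x y z w} → IsWord x y z w → IsWord x y (x ℕ.+ z) (y ℕ.+ w)
inner-IsWord {x} {y} {z} {w} (k , u , eq) = suc k , inner ∷ u ,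
  trans (cong (matrix (step inner) ∙ₘ_) eq) (inner-∙ₘ (+ x) (+ y) (+ z) (+ w))

outer-IsWord : ∀ {x y z w} → IsWord x y z w → IsWord (z ℕ.+ x) (w ℕ.+ y) z w
outer-IsWord {x} {y} {z} {w} (k , u , eq) = suc k , outer ∷ u , trans
  (trans (cong (matrix (step outer) ∙ₘ_) eq) (outer-∙ₘ (+ x) (+ y) (+ z) (+ w)))
  (mat-cong (cong +_ (ℕ.+-comm x z)) (cong +_ (ℕ.+-comm y w)) refl refl)

m≢m+1+n : ∀ {m} n → ¬ m ≡ m ℕ.+ (1 ℕ.+ n)
m≢m+1+n {m} n eq with () ← ℕ.+-cancelˡ-≡ m 0 (1 ℕ.+ n) (trans (ℕ.+-identityʳ m) eq)

private
  expand-inner′ : ∀ x y k → 1 ℕ.+ y ℕ.* (x ℕ.+ k) ≡ x ℕ.* y ℕ.+ (1 ℕ.+ y ℕ.* k)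
  expand-inner′ = ℕ-Solver.solve-∀

  expand-outer : ∀ z w k → (z ℕ.+ k) ℕ.* w ≡ w ℕ.* z ℕ.+ k ℕ.* w
  expand-outer = ℕ-Solver.solve-∀

  expand-outer′ : ∀ z w j → 1 ℕ.+ (w ℕ.+ j) ℕ.* z ≡ w ℕ.* z ℕ.+ (1 ℕ.+ j ℕ.* z)
  expand-outer′ = ℕ-Solver.solve-∀

  measure-inner : ∀ x y k j → (1 ℕ.+ x) ℕ.+ y ℕ.+ (1 ℕ.+ x ℕ.+ k) ℕ.+ (y ℕ.+ j) ≡
                  1 ℕ.+ (((1 ℕ.+ x) ℕ.+ y ℕ.+ k ℕ.+ j) ℕ.+ (x ℕ.+ y))
  measure-inner = ℕ-Solver.solve-∀

  measure-outer : ∀ z w k j → (z ℕ.+ k) ℕ.+ ((1 ℕ.+ w) ℕ.+ j) ℕ.+ z ℕ.+ (1 ℕ.+ w) ≡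
                  1 ℕ.+ ((k ℕ.+ j ℕ.+ z ℕ.+ (1 ℕ.+ w)) ℕ.+ (z ℕ.+ w))
  measure-outer = ℕ-Solver.solve-∀

  expand-cross : ∀ x w k j → 1 ℕ.+ (w ℕ.+ j) ℕ.* (x ℕ.+ k) ≡
                 x ℕ.* w ℕ.+ (1 ℕ.+ (w ℕ.* k ℕ.+ j ℕ.* x ℕ.+ j ℕ.* k))
  expand-cross = ℕ-Solver.solve-∀

  expand-diagonal : ∀ z y k j → (z ℕ.+ (1 ℕ.+ k)) ℕ.* (y ℕ.+ (1 ℕ.+ j)) ≡
                    (1 ℕ.+ y ℕ.* z) ℕ.+ (z ℕ.* (1 ℕ.+ j) ℕ.+ (1 ℕ.+ k) ℕ.* y ℕ.+ (k ℕ.+ j ℕ.+ k ℕ.* j))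
  expand-diagonal = ℕ-Solver.solve-∀

inner-det : ∀ x y k j → x ℕ.* (y ℕ.+ j) ≡ 1 ℕ.+ y ℕ.* (x ℕ.+ k) → x ℕ.* j ≡ 1 ℕ.+ y ℕ.* k
inner-det x y k j eq = ℕ.+-cancelˡ-≡ (x ℕ.* y) (x ℕ.* j) (1 ℕ.+ y ℕ.* k)
  (trans (sym (ℕ.*-distribˡ-+ x y j)) (trans eq (expand-inner′ x y k)))

outer-det : ∀ z w k j → (z ℕ.+ k) ℕ.* w ≡ 1 ℕ.+ (w ℕ.+ j) ℕ.* z → k ℕ.* w ≡ 1 ℕ.+ j ℕ.* z
outer-det z w k j eq = ℕ.+-cancelˡ-≡ (w ℕ.* z) (k ℕ.* w) (1 ℕ.+ j ℕ.* z)
  (trans (sym (expand-outer z w k)) (trans eq (expand-outer′ z w j)))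

-- Euclidean descent on the rows: when one row dominates the other entrywise, subtracting it splits
-- off a step on the left and lowers the sum of the entries, which `bound` controls. Determinant 1
-- makes the rows comparable except for the identity matrix, where the word is empty.
det≡1⇒IsWord : ∀ bound x y z w → x ℕ.+ y ℕ.+ z ℕ.+ w ℕ.≤ bound → x ℕ.* w ≡ 1 ℕ.+ y ℕ.* z → IsWord x y z w

private
  peel-inner : ∀ n x y z w → x ℕ.+ y ℕ.+ z ℕ.+ w ℕ.≤ suc n → x ℕ.* w ≡ 1 ℕ.+ y ℕ.* z →
               x ℕ.≤ z → y ℕ.≤ w → IsWord x y z w
  peel-inner n (suc x) y z w bound det x≤z y≤w
    with k , refl ← ℕ.m≤n⇒∃[o]m+o≡n x≤z | j , refl ← ℕ.m≤n⇒∃[o]m+o≡n y≤w =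
    inner-IsWord (det≡1⇒IsWord n (suc x) y k j
      (ℕ.≤-trans (ℕ.m≤m+n _ (x ℕ.+ y)) (ℕ.≤-pred (subst (ℕ._≤ suc n) (measure-inner x y k j) bound)))
      (inner-det (suc x) y k j det))

  peel-outer : ∀ n x y z w → x ℕ.+ y ℕ.+ z ℕ.+ w ℕ.≤ suc n → x ℕ.* w ≡ 1 ℕ.+ y ℕ.* z →
               z ℕ.≤ x → w ℕ.≤ y → IsWord x y z w
  peel-outer n x y z zero    bound det z≤x w≤y with () ← trans (sym (ℕ.*-zeroʳ x)) det
  peel-outer n x y z (suc w) bound det z≤x w≤y
    with k , refl ← ℕ.m≤n⇒∃[o]m+o≡n z≤x | j , refl ← ℕ.m≤n⇒∃[o]m+o≡n w≤y =
    outer-IsWord (det≡1⇒IsWord n k j z (suc w)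
      (ℕ.≤-trans (ℕ.m≤m+n _ (z ℕ.+ w)) (ℕ.≤-pred (subst (ℕ._≤ suc n) (measure-outer z w k j) bound)))
      (outer-det z (suc w) k j det))

det≡1⇒IsWord zero    zero    _ _ _ _  ()
det≡1⇒IsWord zero    (suc _) _ _ _ () _
det≡1⇒IsWord (suc n) x y z w bound det with ℕ.≤-total x z | ℕ.≤-total y w
... | inj₁ x≤z | inj₁ y≤w = peel-inner n x y z w bound det x≤z y≤w
... | inj₂ z≤x | inj₂ w≤y = peel-outer n x y z w bound det z≤x w≤y
... | inj₁ x≤z | inj₂ w≤y with k , refl ← ℕ.m≤n⇒∃[o]m+o≡n x≤z | j , refl ← ℕ.m≤n⇒∃[o]m+o≡n w≤y =
  contradiction (trans det (expand-cross x w k j)) (m≢m+1+n (w ℕ.* k ℕ.+ j ℕ.* x ℕ.+ j ℕ.* k))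
-- A tie in either column makes the rows comparable after all. If both differences are positive,
-- then xw exceeds 1 + yz unless y = z = 0 and both differences are 1.
... | inj₂ z≤x | inj₁ y≤w with ℕ.m≤n⇒∃[o]m+o≡n z≤x | ℕ.m≤n⇒∃[o]m+o≡n y≤w
... | zero  , refl | _            = peel-inner n x y z w bound det (ℕ.≤-reflexive (ℕ.+-identityʳ z)) y≤w
... | suc k , refl | zero , refl  = peel-outer n x y z w bound det z≤x (ℕ.≤-reflexive (ℕ.+-identityʳ y))
... | suc k , refl | suc j , refl = diagonal z y k j (ℕ.+-cancelˡ-≡ (1 ℕ.+ y ℕ.* z) _ 0
  (trans (sym (expand-diagonal z y k j)) (trans det (sym (ℕ.+-identityʳ (1 ℕ.+ y ℕ.* z))))))
  where
  diagonal : ∀ z y k j → z ℕ.* (1 ℕ.+ j) ℕ.+ (1 ℕ.+ k) ℕ.* y ℕ.+ (k ℕ.+ j ℕ.+ k ℕ.* j) ≡ 0 →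
             IsWord (z ℕ.+ suc k) y z (y ℕ.+ suc j)
  diagonal zero zero zero zero _ = 0 , [] , refl
  diagonal zero zero zero (suc _) ()
  diagonal zero zero (suc k) _ eq with () ← ℕ.m+n≡0⇒n≡0 ((2 ℕ.+ k) ℕ.* 0) eq
  diagonal zero (suc _) _ _ ()

-- Splitting off the outermost letters of a period

private
  subtract-gap : ∀ b c k j → 1 ℕ.+ ((1 ℕ.+ b ℕ.+ k) ℕ.+ c) ℕ.+ j ≡ b ℕ.+ (2 ℕ.+ c ℕ.+ k ℕ.+ j)
  subtract-gap = ℕ-Solver.solve-∀

  expand-gap : ∀ b c k j → (1 ℕ.+ b ℕ.+ k) ℕ.* (2 ℕ.+ c ℕ.+ k ℕ.+ j) ≡
               (1 ℕ.+ b ℕ.* c)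
               ℕ.+ (1 ℕ.+ (b ℕ.* (2 ℕ.+ k ℕ.+ j) ℕ.+ (c ℕ.+ k ℕ.+ j ℕ.+ k ℕ.* (2 ℕ.+ c ℕ.+ k ℕ.+ j))))
  expand-gap = ℕ-Solver.solve-∀

-- If a > b, then d - c > a - b ≥ 1 gives d ≥ c + 2, and ad ≥ (b + 1)(c + 2) exceeds 1 + bc.
gap⇒a≤b : ∀ a b c d → a ℕ.* d ≡ 1 ℕ.+ b ℕ.* c → a ℕ.+ c ℕ.< d ℕ.+ b → a ℕ.≤ b
gap⇒a≤b a b c d det lt with ℕ.≤-<-connex a b
... | inj₁ a≤b = a≤b
... | inj₂ b<a with k , refl ← ℕ.m≤n⇒∃[o]m+o≡n b<a | j , eq ← ℕ.m≤n⇒∃[o]m+o≡n lt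
  with refl ← ℕ.+-cancelˡ-≡ b (2 ℕ.+ c ℕ.+ k ℕ.+ j) d
              (trans (sym (subtract-gap b c k j)) (trans eq (ℕ.+-comm d b))) =
  contradiction (trans (sym det) (expand-gap b c k j)) (m≢m+1+n _)

-- (a b; c d) = (1 0; 1 1)(x y; z w)(1 1; 0 1); the hypotheses say that d - a > |b - c|.
factor-period : ∀ a b c d → a ℕ.* d ≡ 1 ℕ.+ b ℕ.* c → a ℕ.+ c ℕ.< d ℕ.+ b → a ℕ.+ b ℕ.< d ℕ.+ c →
                ∃[ x ] ∃[ y ] ∃[ z ] ∃[ w ]
                  a ≡ x × b ≡ x ℕ.+ y × c ≡ x ℕ.+ z × d ≡ x ℕ.+ y ℕ.+ z ℕ.+ w × x ℕ.* w ≡ 1 ℕ.+ y ℕ.* z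
factor-period a b c d det c-b<d-a b-c<d-a
  with y , refl ← ℕ.m≤n⇒∃[o]m+o≡n (gap⇒a≤b a b c d det c-b<d-a)
     | z , refl ← ℕ.m≤n⇒∃[o]m+o≡n (gap⇒a≤b a c b d (trans det (cong suc (ℕ.*-comm b c))) b-c<d-a)
  with ℕ.≤-total (a ℕ.+ y ℕ.+ z) d
... | inj₁ le with w , refl ← ℕ.m≤n⇒∃[o]m+o≡n le = a , y , z , w , refl , refl , refl , refl ,
  ℕ.+-cancelˡ-≡ (a ℕ.* (a ℕ.+ y ℕ.+ z)) (a ℕ.* w) (1 ℕ.+ y ℕ.* z)
    (trans (sym (ℕ.*-distribˡ-+ a (a ℕ.+ y ℕ.+ z) w)) (trans det (expand a y z)))
  where
  expand : ∀ a y z → 1 ℕ.+ (a ℕ.+ y) ℕ.* (a ℕ.+ z) ≡ a ℕ.* (a ℕ.+ y ℕ.+ z) ℕ.+ (1 ℕ.+ y ℕ.* z)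
  expand = ℕ-Solver.solve-∀
-- Since (a + y)(a + z) = a(a + y + z) + yz, the determinant makes ad larger than a(a + y + z), so d
-- cannot be at most a + y + z.
... | inj₂ ge with o , eq ← ℕ.m≤n⇒∃[o]m+o≡n ge = contradiction
  (trans (cong (a ℕ.*_) (sym eq)) (trans (ℕ.*-distribˡ-+ a d o)
    (trans (cong (ℕ._+ a ℕ.* o) det) (expand a y z (a ℕ.* o)))))
  (m≢m+1+n _)
  where
  expand : ∀ a y z t → 1 ℕ.+ (a ℕ.+ y) ℕ.* (a ℕ.+ z) ℕ.+ t ≡ a ℕ.* (a ℕ.+ y ℕ.+ z) ℕ.+ (1 ℕ.+ (y ℕ.* z ℕ.+ t))
  expand = ℕ-Solver.solve-∀

-- Gauss reduction

0<+[1+_] : ∀ n → 0ℤ < +[1+ n ]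
0<+[1+ n ] = +<+ (s≤s z≤n)

pos+pos : ∀ {i j} → 0ℤ < i → 0ℤ < j → 0ℤ < i + j
pos+pos = ℤₚ.+-mono-<

pos*pos : ∀ {i j} → 0ℤ < i → 0ℤ < j → 0ℤ < i * j
pos*pos {+[1+ m ]} {+[1+ n ]} _ _ = 0<+[1+ _ ]
pos*pos {+0}       (+<+ ())
pos*pos {+[1+ m ]} {+0} _ (+<+ ())

pos*⇒pos : ∀ {i j} → 0ℤ < i → 0ℤ < i * j → 0ℤ < j
pos*⇒pos {+[1+ m ]} {j} _ 0<ij =
  ℤₚ.*-cancelˡ-<-nonNeg +[1+ m ] (subst (_< +[1+ m ] * j) (sym (ℤₚ.*-zeroʳ +[1+ m ])) 0<ij)
pos*⇒pos {+0} (+<+ ())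

i<j⇒0<j-i : ∀ {i j} → i < j → 0ℤ < j - i
i<j⇒0<j-i {i} {j} i<j = subst (_< j - i) (ℤₚ.+-inverseʳ i) (ℤₚ.+-monoˡ-< (- i) i<j)

0<j-i⇒i<j : ∀ {i j} → 0ℤ < j - i → i < j
0<j-i⇒i<j {i} {j} 0<j-i = subst₂ _<_ (ℤₚ.+-identityʳ i) (cancel i j) (ℤₚ.+-monoʳ-< i 0<j-i)
  where
  cancel : ∀ i j → i + (j - i) ≡ j
  cancel = solve-∀

form-cong : ∀ {A B C A′ B′ C′} → A ≡ A′ → B ≡ B′ → C ≡ C′ → form A B C ≡ form A′ B′ C′
form-cong refl refl refl = refl

-- A > 0 > C and B > |A + C|
Balanced : Form → Set
Balanced (form A B C) = 0ℤ < A × 0ℤ < - C × 0ℤ < A + B + C × 0ℤ < B - A - C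

-- Preserves the discriminant and B, and carries the case A < 0 < C to A > 0 > C.
flip : Form → Form
flip (form A B C) = form (- A) B (- C)

-- `Reduced` with a for |A| and D for the discriminant. Neither changes under `flip`, so the case A
-- < 0 reduces to A > 0.
Gauss : ℤ → ℤ → ℤ → Set
Gauss D a B = √ D < (B + + 2 * a) × + 2 * a - B <√ D × B <√ D

private
  neg-sub : ∀ x y → - (x - y) ≡ y - x
  neg-sub = solve-∀

module _ (a B C : ℤ) where
  private
    D = B * B - + 4 * (a * C)

    0<4a : 0ℤ < a → 0ℤ < + 4 * a
    0<4a = pos*pos 0<+[1+ 3 ]

    difference : ∀ a B C → (B + + 2 * a) * (B + + 2 * a) - (B * B - + 4 * (a * C)) ≡ (+ 4 * a) * (a + B + C)
    difference = solve-∀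

    difference′ : ∀ a B C → (B * B - + 4 * (a * C)) - (+ 2 * a - B) * (+ 2 * a - B) ≡ (+ 4 * a) * (B - a - C)
    difference′ = solve-∀

    difference″ : ∀ a B C → (B * B - + 4 * (a * C)) - B * B ≡ (+ 4 * a) * - C
    difference″ = solve-∀

    squares : ∀ a B → (+ 2 * a - B) * (+ 2 * a - B) - (B + + 2 * a) * (B + + 2 * a) ≡ + 8 * (a * - B)
    squares = solve-∀

    sum : ∀ a B C → (a + B + C) + (a + - C) ≡ B + + 2 * a
    sum = solve-∀

    sum′ : ∀ a B C → (B - + 2 * a) + (a + - C) ≡ B - a - C
    sum′ = solve-∀

  -- Each cut compares D with a square, and the difference factors: (B + 2a)² - D = 4a(a + B + C), D
  -- - (2a - B)² = 4a(B - a - C) and D - B² = -4aC. The work lies in the cuts that hold merely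
  -- because their argument is negative.
  Gauss⇒Balanced : 0ℤ < a → Gauss D a B → Balanced (form a B C)
  Gauss⇒Balanced 0<a ((_ , D<[B+2a]²) , 2a-B<√D , B<√D) = 0<a , 0<-C , 0<a+B+C , 0<B-a-C 2a-B<√D
    where
    B²<D : + 2 * a - B <√ D → B <√ D → B * B < D
    B²<D _ (inj₂ lt) = lt
    B²<D (inj₁ 2a-B<0) (inj₁ B<0) =
      contradiction (pos+pos (pos*pos 0<+[1+ 1 ] 0<a) (ℤₚ.neg-mono-< B<0)) (ℤₚ.<-asym 2a-B<0)
    -- A negative B would give (2a - B)² > (2a + B)², while D lies strictly between these squares in
    -- the opposite order.
    B²<D (inj₂ [2a-B]²<D) (inj₁ B<0) = contradiction (ℤₚ.<-trans [2a-B]²<D D<[B+2a]²) (ℤₚ.<-asym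
      (0<j-i⇒i<j (subst (0ℤ <_) (sym (squares a B)) (pos*pos 0<+[1+ 7 ] (pos*pos 0<a (ℤₚ.neg-mono-< B<0))))))

    0<-C : 0ℤ < - C
    0<-C = pos*⇒pos (0<4a 0<a) (subst (0ℤ <_) (difference″ a B C) (i<j⇒0<j-i (B²<D 2a-B<√D B<√D)))

    0<a+B+C : 0ℤ < a + B + C
    0<a+B+C = pos*⇒pos (0<4a 0<a) (subst (0ℤ <_) (difference a B C) (i<j⇒0<j-i D<[B+2a]²))

    0<B-a-C : + 2 * a - B <√ D → 0ℤ < B - a - C
    0<B-a-C (inj₁ 2a-B<0) = subst (0ℤ <_) (sum′ a B C)
      (pos+pos (subst (0ℤ <_) (neg-sub (+ 2 * a) B) (ℤₚ.neg-mono-< 2a-B<0)) (pos+pos 0<a 0<-C))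
    0<B-a-C (inj₂ [2a-B]²<D) =
      pos*⇒pos (0<4a 0<a) (subst (0ℤ <_) (difference′ a B C) (i<j⇒0<j-i [2a-B]²<D))

  Balanced⇒Gauss : Balanced (form a B C) → Gauss D a B
  Balanced⇒Gauss (0<a , 0<-C , 0<a+B+C , 0<B-a-C) =
      ( ℤₚ.<⇒≤ (subst (0ℤ <_) (sum a B C) (pos+pos 0<a+B+C (pos+pos 0<a 0<-C)))
      , 0<j-i⇒i<j (subst (0ℤ <_) (sym (difference a B C)) (pos*pos (0<4a 0<a) 0<a+B+C)))
    , inj₂ (0<j-i⇒i<j (subst (0ℤ <_) (sym (difference′ a B C)) (pos*pos (0<4a 0<a) 0<B-a-C)))
    , inj₂ (0<j-i⇒i<j (subst (0ℤ <_) (sym (difference″ a B C)) (pos*pos (0<4a 0<a) 0<-C)))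

private
  flip-Δ : ∀ a B C → B * B - + 4 * (- a * C) ≡ B * B - + 4 * (a * - C)
  flip-Δ = solve-∀

  Δ-degenerate : ∀ B C → B * B - + 4 * (0ℤ * C) ≡ B * B
  Δ-degenerate = solve-∀

  B+2*0 : ∀ B → B + + 2 * 0ℤ ≡ B
  B+2*0 = solve-∀

Reduced⇒Balanced : ∀ g → Reduced g → Balanced g ⊎ Balanced (flip g)
Reduced⇒Balanced (form +[1+ k ] B C) red = inj₁ (Gauss⇒Balanced +[1+ k ] B C 0<+[1+ k ] red)
Reduced⇒Balanced (form -[1+ k ] B C) red = inj₂ (Gauss⇒Balanced +[1+ k ] B (- C) 0<+[1+ k ]
  (subst (λ D → Gauss D +[1+ k ] B) (flip-Δ +[1+ k ] B C) red))
-- For A = 0 the discriminant is B², and the first cut would say B² < B².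
Reduced⇒Balanced (form +0 B C) ((0≤B , D<B²) , _ , _) =
  contradiction D<B² (ℤₚ.<-irrefl (trans (Δ-degenerate B C) (sym (cong₂ _*_ (B+2*0 B) (B+2*0 B)))))

Balanced⇒Reduced : ∀ g → Balanced g → Reduced g
Balanced⇒Reduced (form +[1+ k ] B C) bal = Balanced⇒Gauss +[1+ k ] B C bal
Balanced⇒Reduced (form +0 B C) (+<+ () , _)

flip-Balanced⇒Reduced : ∀ g → Balanced (flip g) → Reduced g
flip-Balanced⇒Reduced (form -[1+ k ] B C) bal =
  subst (λ D → Gauss D +[1+ k ] B) (sym (flip-Δ +[1+ k ] B C)) (Balanced⇒Gauss +[1+ k ] B (- C) bal)
flip-Balanced⇒Reduced (form +0 B C) (+<+ () , _)

infixr 7 _⊛_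

_⊛_ : ℤ → Form → Form
k ⊛ form A B C = form (k * A) (k * B) (k * C)

private
  *-sum : ∀ k x y z → k * x + k * y + k * z ≡ k * (x + y + z)
  *-sum = solve-∀

  *-diff : ∀ k x y z → k * y - k * x - k * z ≡ k * (y - x - z)
  *-diff = solve-∀

  *-neg : ∀ k x → - (k * x) ≡ k * - x
  *-neg = solve-∀

Balanced-⊛ : ∀ k f → 0ℤ < k → Balanced f → Balanced (k ⊛ f)
Balanced-⊛ k (form A B C) 0<k (0<A , 0<-C , 0<+ , 0<-) =
    pos*pos 0<k 0<A
  , subst (0ℤ <_) (sym (*-neg k C)) (pos*pos 0<k 0<-C)
  , subst (0ℤ <_) (sym (*-sum k A B C)) (pos*pos 0<k 0<+)
  , subst (0ℤ <_) (sym (*-diff k A B C)) (pos*pos 0<k 0<-)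

⊛-Balanced : ∀ k f → 0ℤ < k → Balanced (k ⊛ f) → Balanced f
⊛-Balanced k (form A B C) 0<k (0<A , 0<-C , 0<+ , 0<-) =
    pos*⇒pos 0<k 0<A
  , pos*⇒pos 0<k (subst (0ℤ <_) (*-neg k C) 0<-C)
  , pos*⇒pos 0<k (subst (0ℤ <_) (*-sum k A B C) 0<+)
  , pos*⇒pos 0<k (subst (0ℤ <_) (*-diff k A B C) 0<-)

flip-⊛ : ∀ k f → flip (k ⊛ f) ≡ k ⊛ flip f
flip-⊛ k (form A B C) = form-cong (*-neg k A) refl (*-neg k C)

-- The form fixed by a matrix

private
  ·-∙-square : ∀ a b c d x z A B C →
    (A * (a * a) + B * (a * c) + C * (c * c)) * (x * x)
    + (+ 2 * (A * (a * b)) + B * (a * d + b * c) + + 2 * (C * (c * d))) * (x * z)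
    + (A * (b * b) + B * (b * d) + C * (d * d)) * (z * z)
    ≡ A * ((a * x + b * z) * (a * x + b * z)) + B * ((a * x + b * z) * (c * x + d * z))
      + C * ((c * x + d * z) * (c * x + d * z))
  ·-∙-square = solve-∀

  ·-∙-mixed : ∀ a b c d x y z w A B C →
    + 2 * ((A * (a * a) + B * (a * c) + C * (c * c)) * (x * y))
    + (+ 2 * (A * (a * b)) + B * (a * d + b * c) + + 2 * (C * (c * d))) * (x * w + y * z)
    + + 2 * ((A * (b * b) + B * (b * d) + C * (d * d)) * (z * w))
    ≡ + 2 * (A * ((a * x + b * z) * (a * y + b * w)))
      + B * ((a * x + b * z) * (c * y + d * w) + (a * y + b * w) * (c * x + d * z))
      + + 2 * (C * ((c * x + d * z) * (c * y + d * w)))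
  ·-∙-mixed = solve-∀

  neg-square : ∀ a c A B C →
    A * (- a * - a) + B * (- a * - c) + C * (- c * - c) ≡ A * (a * a) + B * (a * c) + C * (c * c)
  neg-square = solve-∀

  neg-mixed : ∀ a b c d A B C →
    + 2 * (A * (- a * - b)) + B * (- a * - d + - b * - c) + + 2 * (C * (- c * - d))
    ≡ + 2 * (A * (a * b)) + B * (a * d + b * c) + + 2 * (C * (c * d))
  neg-mixed = solve-∀

  1-A : ∀ A B C → A * (1ℤ * 1ℤ) + B * (1ℤ * 0ℤ) + C * (0ℤ * 0ℤ) ≡ A
  1-A = solve-∀

  1-B : ∀ A B C → + 2 * (A * (1ℤ * 0ℤ)) + B * (1ℤ * 1ℤ + 0ℤ * 0ℤ) + + 2 * (C * (0ℤ * 1ℤ)) ≡ B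
  1-B = solve-∀

  1-C : ∀ A B C → A * (0ℤ * 0ℤ) + B * (0ℤ * 1ℤ) + C * (1ℤ * 1ℤ) ≡ C
  1-C = solve-∀

  S-B : ∀ A B C → + 2 * (A * (0ℤ * - 1ℤ)) + B * (0ℤ * 0ℤ + - 1ℤ * 1ℤ) + + 2 * (C * (1ℤ * 0ℤ)) ≡ - B
  S-B = solve-∀

  S-C : ∀ A B C → A * (- 1ℤ * - 1ℤ) + B * (- 1ℤ * 0ℤ) + C * (0ℤ * 0ℤ) ≡ A
  S-C = solve-∀

  scale-square : ∀ k a c A B C →
    (k * A) * (a * a) + (k * B) * (a * c) + (k * C) * (c * c) ≡ k * (A * (a * a) + B * (a * c) + C * (c * c))
  scale-square = solve-∀

  scale-mixed : ∀ k a b c d A B C →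
    + 2 * ((k * A) * (a * b)) + (k * B) * (a * d + b * c) + + 2 * ((k * C) * (c * d))
    ≡ k * (+ 2 * (A * (a * b)) + B * (a * d + b * c) + + 2 * (C * (c * d)))
  scale-mixed = solve-∀

-- Substitution is a right action. Left multiplication of W by a matrix that fixes f therefore
-- leaves W · f unchanged, and labels descend to the quotient by ⟨M⟩.
·-∙ : ∀ V U f → V · U · f ≡ (U ∙ V) · f
·-∙ ⟪ mat x y z w , _ ⟫ ⟪ mat a b c d , _ ⟫ (form A B C) = form-cong
  (·-∙-square a b c d x z A B C) (·-∙-mixed a b c d x y z w A B C) (·-∙-square a b c d y w A B C)

𝟙-· : ∀ f → 𝟙 · f ≡ f
𝟙-· (form A B C) = form-cong (1-A A B C) (1-B A B C) (1-C A B C)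

S-· : ∀ A B C → S · form A B C ≡ form C (- B) A
S-· A B C = form-cong (1-C A B C) (S-B A B C) (S-C A B C)

·-⊛ : ∀ U k f → U · (k ⊛ f) ≡ k ⊛ U · f
·-⊛ ⟪ mat a b c d , _ ⟫ k (form A B C) =
  form-cong (scale-square k a c A B C) (scale-mixed k a b c d A B C) (scale-square k b d A B C)

·-congˡ : ∀ {U V} f → U ≈ V → U · f ≡ V · f
·-congˡ f            (inj₁ refl) = refl
·-congˡ {V = ⟪ mat a b c d , _ ⟫} (form A B C) (inj₂ refl) =
  form-cong (neg-square a c A B C) (neg-mixed a b c d A B C) (neg-square b d A B C)

trace : Mat → ℤ
trace (mat p q r s) = p + s

-- Its roots are the fixed points of the Möbius transformation z ↦ (pz + q) / (rz + s).
fixedForm : Mat → Form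
fixedForm (mat p q r s) = form r (s - p) (- q)

private
  conj-r : ∀ a b c d p q r s →
    - c * (p * a + q * c) + a * (r * a + s * c) ≡ r * (a * a) + (s - p) * (a * c) + - q * (c * c)
  conj-r = solve-∀

  conj-s-p : ∀ a b c d p q r s →
    (- c * (p * b + q * d) + a * (r * b + s * d)) - (d * (p * a + q * c) + - b * (r * a + s * c))
    ≡ + 2 * (r * (a * b)) + (s - p) * (a * d + b * c) + + 2 * (- q * (c * d))
  conj-s-p = solve-∀

  conj-q : ∀ a b c d p q r s →
    - (d * (p * b + q * d) + - b * (r * b + s * d)) ≡ r * (b * b) + (s - p) * (b * d) + - q * (d * d)
  conj-q = solve-∀

  conj-trace : ∀ a b c d p q r s →
    (d * (p * a + q * c) + - b * (r * a + s * c)) + (- c * (p * b + q * d) + a * (r * b + s * d))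
    ≡ (p + s) * (a * d - b * c)
  conj-trace = solve-∀

fixedForm-conj : ∀ V M → fixedForm (matrix (V ⁻¹ ∙ (M ∙ V))) ≡ V · fixedForm (matrix M)
fixedForm-conj ⟪ mat a b c d , _ ⟫ ⟪ mat p q r s , _ ⟫ =
  form-cong (conj-r a b c d p q r s) (conj-s-p a b c d p q r s) (conj-q a b c d p q r s)

trace-conj : ∀ V M → trace (matrix (V ⁻¹ ∙ (M ∙ V))) ≡ trace (matrix M)
trace-conj ⟪ mat a b c d , ad-bc≡1 ⟫ ⟪ mat p q r s , _ ⟫ = trans (conj-trace a b c d p q r s)
  (trans (cong ((p + s) *_) ad-bc≡1) (ℤₚ.*-identityʳ (p + s)))

-- For the distinguished generator of Aut(f) this is a positive multiple of f.
orientedForm : Mat → Form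
orientedForm N = sgn (trace N) ⊛ fixedForm N

private
  sgn-neg : ∀ i → sgn (- i) ≡ - sgn i
  sgn-neg +0       = refl
  sgn-neg +[1+ _ ] = refl
  sgn-neg -[1+ _ ] = refl

  neg-+ : ∀ x y → - x + - y ≡ - (x + y)
  neg-+ = solve-∀

  cancel-signs : ∀ x y → - x * - y ≡ x * y
  cancel-signs = solve-∀

  cancel-signs′ : ∀ x y z → - x * (- y - - z) ≡ x * (y - z)
  cancel-signs′ = solve-∀

-- The trace and the fixed form both change sign, and the two signs cancel.
orientedForm-neg : ∀ N → orientedForm (-ₘ N) ≡ orientedForm N
orientedForm-neg (mat p q r s) = trans
  (cong (_⊛ form (- r) (- s - - p) (- (- q))) (trans (cong sgn (neg-+ p s)) (sgn-neg (p + s))))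
  (form-cong (cancel-signs (sgn (p + s)) r) (cancel-signs′ (sgn (p + s)) s p) (cancel-signs (sgn (p + s)) (- q)))

orientedForm-cong : ∀ {U V} → U ≈ V → orientedForm (matrix U) ≡ orientedForm (matrix V)
orientedForm-cong         (inj₁ eq) = cong orientedForm eq
orientedForm-cong {V = V} (inj₂ eq) = trans (cong orientedForm eq) (orientedForm-neg (matrix V))

orientedForm-conj : ∀ V M → orientedForm (matrix (V ⁻¹ ∙ (M ∙ V))) ≡ V · orientedForm (matrix M)
orientedForm-conj V M = trans (cong₂ (λ t g → sgn t ⊛ g) (trace-conj V M) (fixedForm-conj V M))
  (sym (·-⊛ V (sgn (trace (matrix M))) (fixedForm (matrix M))))

orientedForm-pos : ∀ N → 0ℤ < trace N → orientedForm N ≡ fixedForm N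
orientedForm-pos (mat p q r s) 0<t = trans (cong (_⊛ form r (s - p) (- q)) (sgn-pos 0<t))
  (form-cong (ℤₚ.*-identityˡ r) (ℤₚ.*-identityˡ (s - p)) (ℤₚ.*-identityˡ (- q)))
  where
  sgn-pos : ∀ {i} → 0ℤ < i → sgn i ≡ 1ℤ
  sgn-pos {+[1+ _ ]} _ = refl
  sgn-pos {+0} (+<+ ())

infix 4 _∝_

-- Proportionality by a positive rational with the denominator cleared, as in the field `multiple`
-- of `IsM`.
_∝_ : Form → Form → Set
f ∝ g = ∃[ n ] ∃[ m ] 0ℤ < n × 0ℤ < m × n ⊛ f ≡ m ⊛ g

∝-sym : ∀ {f g} → f ∝ g → g ∝ f
∝-sym (n , m , 0<n , 0<m , eq) = m , n , 0<m , 0<n , sym eq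

·-∝ : ∀ U {f g} → f ∝ g → U · f ∝ U · g
·-∝ U {f} {g} (n , m , 0<n , 0<m , eq) =
  n , m , 0<n , 0<m , trans (sym (·-⊛ U n f)) (trans (cong (U ·_) eq) (·-⊛ U m g))

flip-∝ : ∀ {f g} → f ∝ g → flip f ∝ flip g
flip-∝ {f} {g} (n , m , 0<n , 0<m , eq) =
  n , m , 0<n , 0<m , trans (sym (flip-⊛ n f)) (trans (cong flip eq) (flip-⊛ m g))

Balanced-∝ : ∀ {f g} → f ∝ g → Balanced f → Balanced g
Balanced-∝ {f} {g} (n , m , 0<n , 0<m , eq) bal =
  ⊛-Balanced m g 0<m (subst Balanced eq (Balanced-⊛ n f 0<n bal))

IsM⇒∝ : ∀ {f M} → IsM f M → orientedForm (matrix M) ∝ f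
IsM⇒∝ {form A B C} {⟪ mat p q r s , _ ⟫} record { m = suc m ; n = suc n ; multiple = α , β , γ } =
  +[1+ n ] , +[1+ m ] , 0<+[1+ n ] , 0<+[1+ m ] , form-cong α β γ

orientedForm-conj-∝ : ∀ {f M} V → IsM f M → orientedForm (matrix (V ⁻¹ ∙ (M ∙ V))) ∝ V · f
orientedForm-conj-∝ {f} {M} V isM = subst (_∝ V · f) (sym (orientedForm-conj V M)) (·-∝ V (IsM⇒∝ isM))

fixedForm-∝ : ∀ {U V g} → U ≈ V → 0ℤ < trace (matrix V) → orientedForm (matrix U) ∝ g →
              fixedForm (matrix V) ∝ g
fixedForm-∝ {U} {V} {g} eq 0<t =
  subst (_∝ g) (trans (orientedForm-cong {U} {V} eq) (orientedForm-pos (matrix V) 0<t))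

-- Turns of the axis

rot : Side → SL₂
rot inner = R ∙ R
rot outer = R

opposite : Side → Side
opposite inner = outer
opposite outer = inner

rot-S : ∀ e → rot e ∙ S ≈ step e
rot-S inner = inj₂ refl
rot-S outer = inj₂ refl

𝟙≉rot : ∀ e → 𝟙 ≉ rot e
𝟙≉rot inner (inj₁ ())
𝟙≉rot inner (inj₂ ())
𝟙≉rot outer (inj₁ ())
𝟙≉rot outer (inj₂ ())

-- R has order 3 in PSL₂(ℤ). Hence the turn that leads from the incoming to the outgoing edge, made
-- once more, leads on to the branch.
rot-opposite : ∀ e → rot (opposite e) ≈ rot e ∙ rot e
rot-opposite inner = inj₂ refl
rot-opposite outer = inj₁ refl

𝟙≉S : 𝟙 ≉ S
𝟙≉S (inj₁ ())
𝟙≉S (inj₂ ())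

Meet•⇒rot : ∀ {V W} → Meet• V W → ∃[ e ] W ≈ V ∙ rot e
Meet•⇒rot {V} {W} (inj₁ W≈V , V≉W)       = contradiction (PSL.sym {W} {V} W≈V) V≉W
Meet•⇒rot         (inj₂ (inj₁ W≈VR) , _)  = outer , W≈VR
Meet•⇒rot         (inj₂ (inj₂ W≈VR²) , _) = inner , W≈VR²

rot⇒Meet• : ∀ {V W} e → W ≈ V ∙ rot e → Meet• V W
rot⇒Meet• {V} {W} inner eq = inj₂ (inj₂ eq) , moves {V} {W} (rot inner) eq (𝟙≉rot inner)
rot⇒Meet• {V} {W} outer eq = inj₂ (inj₁ eq) , moves {V} {W} (rot outer) eq (𝟙≉rot outer)

Meet⊗⇒S : ∀ {V W} → Meet⊗ V W → W ≈ V ∙ S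
Meet⊗⇒S {V} {W} (inj₁ W≈V , V≉W)  = contradiction (PSL.sym {W} {V} W≈V) V≉W
Meet⊗⇒S         (inj₂ W≈VS , _)   = W≈VS

S⇒Meet⊗ : ∀ {V W} → W ≈ V ∙ S → Meet⊗ V W
S⇒Meet⊗ {V} {W} eq = inj₂ eq , moves {V} {W} S eq 𝟙≉S

⊗-end-cong : ∀ {U V} → U ≈ V → ⊗-end U ≡ ⊗-end V
⊗-end-cong (inj₁ refl) = refl
⊗-end-cong {V = ⟪ mat a b c d , _ ⟫} (inj₂ refl) =
  cong₂ (λ x n → point x 1ℤ n) (neg-X a b c d) (neg-X c d c d)
  where
  neg-X : ∀ a b c d → - a * - c + - b * - d ≡ a * c + b * d
  neg-X = solve-∀

orientation-swap : ∀ P Q T → orientation Q P T ≡ - orientation P Q T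
orientation-swap (point X₁ Y₁ N₁) (point X₂ Y₂ N₂) (point X₃ Y₃ N₃) = swap X₁ Y₁ N₁ X₂ Y₂ N₂ X₃ Y₃ N₃
  where
  swap : ∀ X₁ Y₁ N₁ X₂ Y₂ N₂ X₃ Y₃ N₃ →
    X₂ * (Y₁ * N₃ - Y₃ * N₁) - Y₂ * (X₁ * N₃ - X₃ * N₁) + N₂ * (X₁ * Y₃ - X₃ * Y₁) ≡
    - (X₁ * (Y₂ * N₃ - Y₃ * N₂) - Y₁ * (X₂ * N₃ - X₃ * N₂) + N₁ * (X₂ * Y₃ - X₃ * Y₂))
  swap = solve-∀

orientation-rotate : ∀ P Q T → orientation P T Q ≡ - orientation P Q T
orientation-rotate (point X₁ Y₁ N₁) (point X₂ Y₂ N₂) (point X₃ Y₃ N₃) = swap X₁ Y₁ N₁ X₂ Y₂ N₂ X₃ Y₃ N₃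
  where
  swap : ∀ X₁ Y₁ N₁ X₂ Y₂ N₂ X₃ Y₃ N₃ →
    X₁ * (Y₃ * N₂ - Y₂ * N₃) - Y₁ * (X₃ * N₂ - X₂ * N₃) + N₁ * (X₃ * Y₂ - X₂ * Y₃) ≡
    - (X₁ * (Y₂ * N₃ - Y₃ * N₂) - Y₁ * (X₂ * N₃ - X₃ * N₂) + N₁ * (X₂ * Y₃ - X₃ * Y₂))
  swap = solve-∀

0≤i*i : ∀ i → 0ℤ ≤ i * i
0≤i*i (+ zero)  = +≤+ z≤n
0≤i*i +[1+ _ ]  = +≤+ z≤n
0≤i*i -[1+ _ ]  = +≤+ z≤n

-- |c e^{iπ/3} + d|²
norm : SL₂ → ℤ
norm ⟪ mat a b c d , _ ⟫ = c * c + c * d + d * d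

-- Completing the square excludes negative values. The value 0 is excluded by the Gram identity for
-- the two rows under x² + xy + y²: four times the product of their norms equals X² + 3 (det V)²,
-- where X is the polar form of the rows.
0<norm : ∀ V → 0ℤ < norm V
0<norm ⟪ mat a b c d , ad-bc≡1 ⟫ = positive (c * c + c * d + d * d) refl
  where
  P = a * a + a * b + b * b
  X = + 2 * (a * c) + a * d + b * c + + 2 * (b * d)

  complete-square : ∀ c d → (+ 2 * c + d) * (+ 2 * c + d) + + 3 * (d * d) ≡ + 4 * (c * c + c * d + d * d)
  complete-square = solve-∀

  gram : ∀ a b c d →
    (+ 2 * (a * c) + a * d + b * c + + 2 * (b * d)) * (+ 2 * (a * c) + a * d + b * c + + 2 * (b * d))
    + + 3 * ((a * d - b * c) * (a * d - b * c))
    ≡ + 4 * (a * a + a * b + b * b) * (c * c + c * d + d * d)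
  gram = solve-∀

  positive : ∀ q → c * c + c * d + d * d ≡ q → 0ℤ < q
  positive +[1+ n ] _  = 0<+[1+ n ]
  positive +0       eq = contradiction 0<0 (ℤₚ.<-irrefl refl)
    where
    0<0 : 0ℤ < 0ℤ
    0<0 = subst (0ℤ <_)
      (trans (cong (λ δ → X * X + + 3 * (δ * δ)) (sym ad-bc≡1))
        (trans (gram a b c d) (trans (cong (+ 4 * P *_) eq) (ℤₚ.*-zeroʳ (+ 4 * P)))))
      (ℤₚ.+-mono-≤-< (0≤i*i X) 0<+[1+ 2 ])
  positive -[1+ n ] eq with () ← subst (0ℤ ≤_) (trans (complete-square c d) (cong (+ 4 *_) eq))
    (ℤₚ.+-mono-≤ (0≤i*i (+ 2 * c + d)) (ℤₚ.*-monoˡ-≤-nonNeg (+ 3) (0≤i*i d)))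

-- The determinant expands to det V times `norm V`. Its positivity says that V, VR², VR leave their
-- •-vertex counterclockwise, so after a turn by R² the branch VR lies to the left of the axis. This
-- ties the letters to the boundary components.
orientation-rot : ∀ V → orientation (⊗-end V) (⊗-end (V ∙ rot inner)) (⊗-end (V ∙ rot outer)) ≡ norm V
orientation-rot V@(⟪ mat a b c d , ad-bc≡1 ⟫) = trans
  (cong₂ (λ M N → orientation (⊗-end V) (⊗ₘ M) (⊗ₘ N)) V-inner V-outer)
  (trans (expand a b c d) (trans (cong (_* norm V) ad-bc≡1) (ℤₚ.*-identityˡ (norm V))))
  where
  ⊗ₘ : Mat → Point
  ⊗ₘ (mat a b c d) = point (a * c + b * d) 1ℤ (c * c + d * d)

  -x-y : ∀ x y → x * - 1ℤ + y * - 1ℤ ≡ - x - y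
  -x-y = solve-∀

  -x+0 : ∀ x y → x * - 1ℤ + y * 0ℤ ≡ - x
  -x+0 = solve-∀

  V-inner : matrix (V ∙ rot inner) ≡ mat b (- a - b) d (- c - d)
  V-inner = mat-cong (x0+y1 a b) (-x-y a b) (x0+y1 c d) (-x-y c d)

  V-outer : matrix (V ∙ rot outer) ≡ mat (a + b) (- a) (c + d) (- c)
  V-outer = mat-cong (x1+y1 a b) (-x+0 a b) (x1+y1 c d) (-x+0 c d)

  expand : ∀ a b c d →
    (a * c + b * d) * (1ℤ * ((c + d) * (c + d) + - c * - c) - 1ℤ * (d * d + (- c - d) * (- c - d)))
    - 1ℤ * ((b * d + (- a - b) * (- c - d)) * ((c + d) * (c + d) + - c * - c)
            - ((a + b) * (c + d) + - a * - c) * (d * d + (- c - d) * (- c - d)))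
    + (c * c + d * d) * ((b * d + (- a - b) * (- c - d)) * 1ℤ - ((a + b) * (c + d) + - a * - c) * 1ℤ)
    ≡ (a * d - b * c) * (c * c + c * d + d * d)
  expand = solve-∀

To : Side → ∀ {M} → Axis M → ℤ → Set
To inner = ToInner
To outer = ToOuter

module _ {M : SL₂} (γ : Axis M) where
  open Axis γ

  turn : ∀ n → ∃[ e ] from n ≈ into n ∙ rot e
  turn n = Meet•⇒rot {into n} {from n} (at• n)

  into-suc : ∀ {n} e → from n ≈ into n ∙ rot e → into (sucℤ n) ≈ into n ∙ step e
  into-suc {n} e eq = compose {into n} {from n} {into (sucℤ n)} (rot e) S {step e}
    eq (Meet⊗⇒S {from n} {into (sucℤ n)} (at⊗ n)) (rot-S e)

  Branch⇒rot : ∀ {n W} e → from n ≈ into n ∙ rot e → Branch γ n W → W ≈ into n ∙ rot (opposite e)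
  Branch⇒rot {n} {W} e eq (meet , _ , from≉W) with Meet•⇒rot {into n} {W} meet
  Branch⇒rot inner _ _ | outer , W≈ = W≈
  Branch⇒rot outer _ _ | inner , W≈ = W≈
  Branch⇒rot {n} {W} inner eq (_ , _ , from≉W) | inner , W≈ =
    contradiction (PSL.trans {from n} {into n ∙ rot inner} {W} eq (PSL.sym {W} {into n ∙ rot inner} W≈)) from≉W
  Branch⇒rot {n} {W} outer eq (_ , _ , from≉W) | outer , W≈ =
    contradiction (PSL.trans {from n} {into n ∙ rot outer} {W} eq (PSL.sym {W} {into n ∙ rot outer} W≈)) from≉W

  rot⇒Branch : ∀ {n} e → from n ≈ into n ∙ rot e → Branch γ n (into n ∙ rot (opposite e))
  rot⇒Branch {n} e eq =
      rot⇒Meet• {into n} {W} (opposite e) W≈W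
    , rot⇒Meet• {from n} {W} e (relate {into n} {from n} {W}
        (rot e) (rot (opposite e)) (rot e) eq W≈W (rot-opposite e))
    where
    W = into n ∙ rot (opposite e)
    W≈W = PSL.refl {W}

  private
    orient-inner : ∀ {n W} → from n ≈ into n ∙ rot inner → W ≈ into n ∙ rot outer →
                   orientation (⊗-end (into n)) (⊗-end (from n)) (⊗-end W) ≡ norm (into n)
    orient-inner {n} {W} p q = trans
      (cong₂ (orientation (⊗-end (into n))) (⊗-end-cong {from n} {into n ∙ rot inner} p)
        (⊗-end-cong {W} {into n ∙ rot outer} q))
      (orientation-rot (into n))

    orient-outer : ∀ {n W} → from n ≈ into n ∙ rot outer → W ≈ into n ∙ rot inner →
                   orientation (⊗-end (into n)) (⊗-end (from n)) (⊗-end W) ≡ - norm (into n)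
    orient-outer {n} {W} p q = trans
      (cong₂ (orientation (⊗-end (into n))) (⊗-end-cong {from n} {into n ∙ rot outer} p)
        (⊗-end-cong {W} {into n ∙ rot inner} q))
      (trans (orientation-rotate (⊗-end (into n)) (⊗-end (into n ∙ rot inner)) (⊗-end (into n ∙ rot outer)))
        (cong -_ (orientation-rot (into n))))

    orient-swap : ∀ {n W x} → orientation (⊗-end (into n)) (⊗-end (from n)) (⊗-end W) ≡ x →
                  orientation (⊗-end (from n)) (⊗-end (into n)) (⊗-end W) ≡ - x
    orient-swap {n} {W} eq = trans (orientation-swap (⊗-end (into n)) (⊗-end (from n)) (⊗-end W)) (cong -_ eq)

    impossible : ∀ {a} {A : Set a} n → 0ℤ < - norm (into n) → A
    impossible n 0<-norm = contradiction (ℤₚ.<-trans 0<-norm (ℤₚ.neg-mono-< (0<norm (into n)))) (ℤₚ.<-irrefl refl)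

  -- With the other turn, the determinant required to be positive equals - norm (into n).
  To⇒turn : ∀ e {n} → To e γ n → proj₁ (turn n) ≡ e
  To⇒turn inner {n} (W , branch , ccw) with turn n
  ... | inner , eq = refl
  ... | outer , eq = impossible n (subst (0ℤ <_) (orient-outer {W = W} eq (Branch⇒rot {W = W} outer eq branch)) ccw)
  To⇒turn outer {n} (W , branch , ccw) with turn n
  ... | outer , eq = refl
  ... | inner , eq = impossible n
    (subst (0ℤ <_) (orient-swap {W = W} (orient-inner {W = W} eq (Branch⇒rot {W = W} inner eq branch))) ccw)

  rot⇒To : ∀ e {n} → from n ≈ into n ∙ rot e → To e γ n
  rot⇒To inner {n} eq = W , rot⇒Branch inner eq ,
    subst (0ℤ <_) (sym (orient-inner {W = W} eq (PSL.refl {W}))) (0<norm (into n))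
    where W = into n ∙ rot outer
  rot⇒To outer {n} eq = W , rot⇒Branch outer eq ,
    subst (0ℤ <_) (sym (trans (orient-swap {W = W} (orient-outer {W = W} eq (PSL.refl {W})))
        (ℤₚ.neg-involutive (norm (into n)))))
      (0<norm (into n))
    where W = into n ∙ rot inner

-- Reduced edges carry reduced forms

conjugate : ∀ {m v x} → m ∙ v ≈ v ∙ x → v ⁻¹ ∙ (m ∙ v) ≈ x
conjugate {m} {v} {x} eq = PSL.trans {v ⁻¹ ∙ (m ∙ v)} {v ⁻¹ ∙ (v ∙ x)} {x}
  (PSL.∙-cong {v ⁻¹} {v ⁻¹} {m ∙ v} {v ∙ x} (PSL.refl {v ⁻¹}) eq) (\\-leftDividesʳ v x)

conjugate⁻¹ : ∀ {m v x} → v ⁻¹ ∙ (m ∙ v) ≈ x → m ∙ v ≈ v ∙ x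
conjugate⁻¹ {m} {v} {x} eq = PSL.trans {m ∙ v} {v ∙ (v ⁻¹ ∙ (m ∙ v))} {v ∙ x}
  (PSL.sym {v ∙ (v ⁻¹ ∙ (m ∙ v))} {m ∙ v} (\\-leftDividesˡ v (m ∙ v)))
  (PSL.∙-cong {v} {v} {v ⁻¹ ∙ (m ∙ v)} {x} (PSL.refl {v}) eq)

pos+nonneg : ∀ {i j} → 0ℤ < i → 0ℤ ≤ j → 0ℤ < i + j
pos+nonneg = ℤₚ.+-mono-<-≤

nonneg+pos : ∀ {i j} → 0ℤ ≤ i → 0ℤ < j → 0ℤ < i + j
nonneg+pos = ℤₚ.+-mono-≤-<

-- Weak enough to hold for the identity and to survive both steps, strong enough to force a positive
-- trace.
Positive : Mat → Set
Positive (mat a b c d) = 0ℤ < a × 0ℤ ≤ b × 0ℤ ≤ c × 0ℤ < d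

Positive-𝟙 : Positive 1ₘ
Positive-𝟙 = 0<+[1+ 0 ] , +≤+ z≤n , +≤+ z≤n , 0<+[1+ 0 ]

Positive-step : ∀ e U → Positive (matrix U) → Positive (matrix (U ∙ step e))
Positive-step inner ⟪ mat a b c d , _ ⟫ (0<a , 0≤b , 0≤c , 0<d) = subst Positive (sym (∙ₘ-inner a b c d))
  (pos+nonneg 0<a 0≤b , 0≤b , ℤₚ.<⇒≤ (nonneg+pos 0≤c 0<d) , 0<d)
Positive-step outer ⟪ mat a b c d , _ ⟫ (0<a , 0≤b , 0≤c , 0<d) = subst Positive (sym (∙ₘ-outer a b c d))
  (0<a , ℤₚ.<⇒≤ (pos+nonneg 0<a 0≤b) , 0≤c , nonneg+pos 0≤c 0<d)

opposed-traces : ∀ M → 0ℤ < trace M → ¬ 0ℤ < trace (-ₘ M)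
opposed-traces (mat p q r s) 0<t 0<-t =
  ℤₚ.<-asym 0<t (subst (_< 0ℤ) (cancel p s) (ℤₚ.neg-mono-< 0<-t))
  where
  cancel : ∀ p s → - (- p + - s) ≡ p + s
  cancel = solve-∀

-- A positive trace fixes the sign of a representative.
≈⇒≡ : ∀ {U V} → 0ℤ < trace (matrix U) → 0ℤ < trace (matrix V) → U ≈ V → matrix U ≡ matrix V
≈⇒≡         0<tU 0<tV (inj₁ eq) = eq
≈⇒≡ {V = V} 0<tU 0<tV (inj₂ eq) =
  contradiction (subst (λ M → 0ℤ < trace M) eq 0<tU) (opposed-traces (matrix V) 0<tV)

module _ {a b c d x y z w : ℤ} (Y⁺ : Positive (mat a b c d)) (Z⁺ : Positive (mat x y z w)) where
  private
    0<a = proj₁ Y⁺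
    0≤b = proj₁ (proj₂ Y⁺)
    0≤c = proj₁ (proj₂ (proj₂ Y⁺))
    0<d = proj₂ (proj₂ (proj₂ Y⁺))
    0<x = proj₁ Z⁺
    0≤y = proj₁ (proj₂ Z⁺)
    0≤z = proj₁ (proj₂ (proj₂ Z⁺))
    0<w = proj₂ (proj₂ (proj₂ Z⁺))

    sum₁ : ∀ p q c d → (p + c) + ((q + d) - p) + - q ≡ d + c
    sum₁ = solve-∀

    sum₂ : ∀ p r y w → ((r + w) - p) - r - - (p + y) ≡ w + y
    sum₂ = solve-∀

    sum₃ : ∀ a b r s → - (- (b + s)) + - (s - (a + r)) + - r ≡ a + b
    sum₃ = solve-∀

    sum₄ : ∀ x q z s → - (s - (x + q)) - - (- q) - - (z + s) ≡ x + z
    sum₄ = solve-∀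

  -- Each factorisation supplies two of the four inequalities. The left factor L gives A = a + c and
  -- A + B + C = d + c; the right factor T gives -C = x + y and B - A - C = w + y.
  Balanced-inner-outer : mat a b (a + c) (b + d) ≡ mat x (x + y) z (z + w) →
                         Balanced (fixedForm (mat a b (a + c) (b + d)))
  Balanced-inner-outer eq =
      pos+nonneg 0<a 0≤c
    , subst (λ i → 0ℤ < - - i) (sym (cong Mat.b eq))
        (subst (0ℤ <_) (sym (ℤₚ.neg-involutive (x + y))) (pos+nonneg 0<x 0≤y))
    , subst (0ℤ <_) (sym (sum₁ a b c d)) (pos+nonneg 0<d 0≤c)
    , subst (λ M → let form A B C = fixedForm M in 0ℤ < B - A - C) (sym eq)
        (subst (0ℤ <_) (sym (sum₂ x z y w)) (pos+nonneg 0<w 0≤y))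

  Balanced-outer-inner : mat (a + c) (b + d) c d ≡ mat (x + y) y (z + w) w →
                         Balanced (flip (S · fixedForm (mat (a + c) (b + d) c d)))
  Balanced-outer-inner eq = subst (λ g → Balanced (flip g)) (sym (S-· c (d - (a + c)) (- (b + d))))
    ( subst (0ℤ <_) (sym (ℤₚ.neg-involutive (b + d))) (nonneg+pos 0≤b 0<d)
    , subst (λ i → 0ℤ < - - i) (sym (cong Mat.c eq))
        (subst (0ℤ <_) (sym (ℤₚ.neg-involutive (z + w))) (nonneg+pos 0≤z 0<w))
    , subst (0ℤ <_) (sym (sum₃ a b c d)) (pos+nonneg 0<a 0≤b)
    , subst (λ { (mat p q r s) → 0ℤ < - (s - p) - - (- q) - - r }) (sym eq)
        (subst (0ℤ <_) (sym (sum₄ x y z w)) (pos+nonneg 0<x 0≤z)))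

inner-outer-period : ∀ N Y Z g → Positive (matrix Y) → Positive (matrix Z) →
  N ≈ step inner ∙ Y → N ≈ Z ∙ step outer → orientedForm (matrix N) ∝ g → Balanced g
inner-outer-period N Y@(⟪ mat a b c d , _ ⟫) Z@(⟪ mat x y z w , _ ⟫) g
                   Y⁺@(0<a , 0≤b , _ , 0<d) Z⁺@(0<x , _ , 0≤z , 0<w) N≈LY N≈ZT N∝g =
  Balanced-∝ (fixedForm-∝ {N} {step inner ∙ Y} N≈LY 0<trLY N∝g)
    (subst (λ X → Balanced (fixedForm X)) (sym LY)
      (Balanced-inner-outer Y⁺ Z⁺ (trans (sym LY) (trans LY≡ZT ZT))))
  where
  LY = inner-∙ₘ a b c d
  ZT = ∙ₘ-outer x y z w
  0<trLY : 0ℤ < trace (matrix (step inner ∙ Y))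
  0<trLY = subst (λ X → 0ℤ < trace X) (sym LY) (pos+pos 0<a (nonneg+pos 0≤b 0<d))
  0<trZT : 0ℤ < trace (matrix (Z ∙ step outer))
  0<trZT = subst (λ X → 0ℤ < trace X) (sym ZT) (pos+pos 0<x (nonneg+pos 0≤z 0<w))
  LY≡ZT : matrix (step inner ∙ Y) ≡ matrix (Z ∙ step outer)
  LY≡ZT = ≈⇒≡ {step inner ∙ Y} {Z ∙ step outer} 0<trLY 0<trZT
    (PSL.trans {step inner ∙ Y} {N} {Z ∙ step outer} (PSL.sym {N} {step inner ∙ Y} N≈LY) N≈ZT)

outer-inner-period : ∀ N Y Z g → Positive (matrix Y) → Positive (matrix Z) →
  N ≈ step outer ∙ Y → N ≈ Z ∙ step inner → orientedForm (matrix N) ∝ g → Balanced (flip (S · g))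
outer-inner-period N Y@(⟪ mat a b c d , _ ⟫) Z@(⟪ mat x y z w , _ ⟫) g
                   Y⁺@(0<a , _ , 0≤c , 0<d) Z⁺@(0<x , 0≤y , _ , 0<w) N≈TY N≈ZL N∝g =
  Balanced-∝ (flip-∝ (·-∝ S (fixedForm-∝ {N} {step outer ∙ Y} N≈TY 0<trTY N∝g)))
    (subst (λ X → Balanced (flip (S · fixedForm X))) (sym TY)
      (Balanced-outer-inner Y⁺ Z⁺ (trans (sym TY) (trans TY≡ZL ZL))))
  where
  TY = outer-∙ₘ a b c d
  ZL = ∙ₘ-inner x y z w
  0<trTY : 0ℤ < trace (matrix (step outer ∙ Y))
  0<trTY = subst (λ X → 0ℤ < trace X) (sym TY) (pos+pos (pos+nonneg 0<a 0≤c) 0<d)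
  0<trZL : 0ℤ < trace (matrix (Z ∙ step inner))
  0<trZL = subst (λ X → 0ℤ < trace X) (sym ZL) (pos+pos (pos+nonneg 0<x 0≤y) 0<w)
  TY≡ZL : matrix (step outer ∙ Y) ≡ matrix (Z ∙ step inner)
  TY≡ZL = ≈⇒≡ {step outer ∙ Y} {Z ∙ step inner} 0<trTY 0<trZL
    (PSL.trans {step outer ∙ Y} {N} {Z ∙ step inner} (PSL.sym {N} {step outer ∙ Y} N≈TY) N≈ZL)

module _ {M : SL₂} (γ : Axis M) where
  open Axis γ

  side : ℤ → Side
  side n = proj₁ (turn γ n)

  step-side : ∀ n → into (sucℤ n) ≈ into n ∙ step (side n)
  step-side n = into-suc γ (side n) (proj₂ (turn γ n))

  private
    period : ∀ ℓ .{{_ : ℕ.NonZero ℓ}} → (∀ n → M ∙ into n ≈ into (n + + ℓ)) → ∀ j →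
        (∃[ Y ] Positive (matrix Y) × M ∙ into (sucℤ j) ≈ into (sucℤ j) ∙ (step (side (sucℤ j)) ∙ Y))
      × (∃[ Z ] Positive (matrix Z) × M ∙ into (sucℤ j) ≈ into (sucℤ j) ∙ (Z ∙ step (side j)))
    period (suc k) tr j =
        period-headed into (λ n → step (side n)) step-side
          (λ U → Positive (matrix U)) Positive-𝟙 (λ {U} n → Positive-step (side n) U) M k tr (sucℤ j)
      , period-tailed into (λ n → step (side n)) step-side
          (λ U → Positive (matrix U)) Positive-𝟙 (λ {U} n → Positive-step (side n) U) M k tr j

  period-factors : ∀ j {e e′} → side (sucℤ j) ≡ e → side j ≡ e′ →
      (∃[ Y ] Positive (matrix Y) × into (sucℤ j) ⁻¹ ∙ (M ∙ into (sucℤ j)) ≈ step e ∙ Y)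
    × (∃[ Z ] Positive (matrix Z) × into (sucℤ j) ⁻¹ ∙ (M ∙ into (sucℤ j)) ≈ Z ∙ step e′)
  period-factors j refl refl with (Y , Y⁺ , eqY) , (Z , Z⁺ , eqZ) ← period ℓ (λ n → proj₁ (translate n)) j =
      (Y , Y⁺ , conjugate {M} {into (sucℤ j)} {step (side (sucℤ j)) ∙ Y} eqY)
    , (Z , Z⁺ , conjugate {M} {into (sucℤ j)} {Z ∙ step (side j)} eqZ)

module _ {f : Form} {M : SL₂} (isM : IsM f M) (γ : Axis M) where
  open Axis γ

  ToOuter-ToInner⇒Balanced : ∀ j → ToOuter γ j → ToInner γ (sucℤ j) → Balanced (into (sucℤ j) · f)
  ToOuter-ToInner⇒Balanced j o i
    with (Y , Y⁺ , eqY) , (Z , Z⁺ , eqZ) ← period-factors γ j (To⇒turn γ inner i) (To⇒turn γ outer o) =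
    inner-outer-period (V ⁻¹ ∙ (M ∙ V)) Y Z (V · f) Y⁺ Z⁺ eqY eqZ (orientedForm-conj-∝ V isM)
    where V = into (sucℤ j)

  ToInner-ToOuter⇒Balanced : ∀ j → ToInner γ j → ToOuter γ (sucℤ j) → Balanced (flip (S · into (sucℤ j) · f))
  ToInner-ToOuter⇒Balanced j i o
    with (Y , Y⁺ , eqY) , (Z , Z⁺ , eqZ) ← period-factors γ j (To⇒turn γ outer o) (To⇒turn γ inner i) =
    outer-inner-period (V ⁻¹ ∙ (M ∙ V)) Y Z (V · f) Y⁺ Z⁺ eqY eqZ (orientedForm-conj-∝ V isM)
    where V = into (sucℤ j)

  ReducedOn⇒Reduced : ∀ W → ReducedOn γ W → Reduced (W · f)
  ReducedOn⇒Reduced W (n , i , inj₁ (W≈into , o)) = Balanced⇒Reduced (W · f)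
    (subst Balanced (sym (·-congˡ {W} {into n} f W≈into))
      (subst (λ k → Balanced (into k · f)) (ℤₚ.suc-pred n)
        (ToOuter-ToInner⇒Balanced (predℤ n) o (subst (ToInner γ) (sym (ℤₚ.suc-pred n)) i))))
  ReducedOn⇒Reduced W (n , i , inj₂ (W≈from , o)) = flip-Balanced⇒Reduced (W · f)
    (subst (λ g → Balanced (flip g)) (sym W·f≡) (ToInner-ToOuter⇒Balanced n i o))
    where
    V = into (sucℤ n)
    W·f≡ : W · f ≡ S · V · f
    -- The edges `from n` and `into (sucℤ n)` share a ⊗-vertex and so differ by S, which is its own
    -- inverse in PSL₂(ℤ).
    W·f≡ = trans (·-congˡ {W} {from n} f W≈from) (trans
      (·-congˡ {from n} {V ∙ S} f (relate {from n} {V} {from n} S 𝟙 S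
         (Meet⊗⇒S {from n} {V} (at⊗ n)) (PSL.sym {from n ∙ 𝟙} {from n} (PSL.identityʳ (from n))) (inj₂ refl)))
      (sym (·-∙ S V f)))

-- Reduced forms label reduced edges

module _ {M V : SL₂} {k} (u : Vec Side (suc k)) (period : M ∙ V ≈ V ∙ word u) where
  private
    module W = Walk (λ n → step (cyclic u n)) V

    out : ℤ → SL₂
    out n = W.walk n ∙ rot (cyclic u n)

    axis : Axis M
    axis = record
      { into      = W.walk
      ; from      = out
      ; at•       = λ n → rot⇒Meet• {W.walk n} {out n} (cyclic u n) (PSL.refl {out n})
      ; at⊗       = λ n → S⇒Meet⊗ {out n} {W.walk (sucℤ n)}
          (relate {W.walk n} {out n} {W.walk (sucℤ n)} (rot (cyclic u n)) (step (cyclic u n)) S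
            (PSL.refl {out n}) (W.walk-suc n)
            (PSL.sym {rot (cyclic u n) ∙ S} {step (cyclic u n)} (rot-S (cyclic u n))))
      ; ℓ         = suc k
      ; translate = λ n → walks n , subst (λ e → M ∙ out n ≈ W.walk (n + + suc k) ∙ rot e)
          (sym (cyclic-periodic u n))
          (extend {M} {W.walk n} {W.walk (n + + suc k)} (rot (cyclic u n)) (walks n))
      }
      where
      walks = walk-along-word M V u period

  -- The word is repeated cyclically in both directions. The path does not backtrack, because every
  -- letter is a nontrivial rotation at a •-vertex followed by S.
  periodicAxis : Σ[ γ ∈ Axis M ] V ≈ Axis.into γ 0ℤ × (∀ n {e} → cyclic u n ≡ e → To e γ n)
  periodicAxis = axis , PSL.refl {V} , λ { n refl → rot⇒To axis (cyclic u n) (PSL.refl {out n}) }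

pos*∧pos+⇒pos : ∀ {i j} → 0ℤ < i * j → 0ℤ < i + j → 0ℤ < i
pos*∧pos+⇒pos {+[1+ n ]}     _    _ = 0<+[1+ n ]
pos*∧pos+⇒pos {+0}       {j} 0<0j _ = contradiction (subst (0ℤ <_) (ℤₚ.*-zeroˡ j) 0<0j) (ℤₚ.<-irrefl refl)
pos*∧pos+⇒pos { -[1+ n ]} {j} 0<ij 0<sum =
  contradiction 0<ij (ℤₚ.<-asym (subst (-[1+ n ] * j <_) (ℤₚ.*-zeroʳ -[1+ n ]) (ℤₚ.*-monoˡ-<-neg -[1+ n ] 0<j)))
  where
  0<j : 0ℤ < j
  0<j = subst (0ℤ <_) (cancel +[1+ n ] j) (pos+pos 0<+[1+ n ] 0<sum)
    where
    cancel : ∀ i j → i + (- i + j) ≡ j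
    cancel = solve-∀

0<⇒+ : ∀ {i} → 0ℤ < i → ∃[ n ] i ≡ + n
0<⇒+ {+ n} _ = n , refl

private
  split : ∀ p q r s → (p * s - q * r) + q * r ≡ p * s
  split = solve-∀
  rearrange₁ : ∀ a b c d → c + (d - a) + - b ≡ (d + c) - (a + b)
  rearrange₁ = solve-∀
  rearrange₂ : ∀ a b c d → (d - a) - c - - b ≡ (d + b) - (a + c)
  rearrange₂ = solve-∀
  det-ℕ : ∀ a b c d → + a * + d - + b * + c ≡ 1ℤ → + (a ℕ.* d) ≡ + (1 ℕ.+ b ℕ.* c)
  det-ℕ a b c d det = trans (ℤₚ.pos-* a d) (trans (sym (split (+ a) (+ b) (+ c) (+ d)))
    (trans (cong (_+ + b * + c) det) (cong (λ i → 1ℤ + i) (sym (ℤₚ.pos-* b c)))))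

-- Balance makes q and r positive, so ps = 1 + qr is positive and the positive trace makes both p
-- and s positive. The two remaining balance conditions become the inequalities that `factor-period`
-- expects.
natural-entries : ∀ p q r s → p * s - q * r ≡ 1ℤ → 0ℤ < p + s → Balanced (fixedForm (mat p q r s)) →
  ∃[ a ] ∃[ b ] ∃[ c ] ∃[ d ] (p ≡ + a × q ≡ + b × r ≡ + c × s ≡ + d)
    × a ℕ.* d ≡ 1 ℕ.+ b ℕ.* c × a ℕ.+ c ℕ.< d ℕ.+ b × a ℕ.+ b ℕ.< d ℕ.+ c
natural-entries p q r s det 0<t (0<r , 0<--q , 0<sum , 0<diff)
  with 0<q ← subst (0ℤ <_) (ℤₚ.neg-involutive q) 0<--q
  with 0<ps ← subst (0ℤ <_) (trans (cong (_+ q * r) (sym det)) (split p q r s))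
              (pos+pos 0<+[1+ 0 ] (pos*pos 0<q 0<r))
  with a , refl ← 0<⇒+ (pos*∧pos+⇒pos {p} {s} 0<ps 0<t)
     | b , refl ← 0<⇒+ 0<q
     | c , refl ← 0<⇒+ 0<r
     | d , refl ← 0<⇒+ (pos*∧pos+⇒pos {s} {p} (subst (0ℤ <_) (ℤₚ.*-comm p s) 0<ps)
                                         (subst (0ℤ <_) (ℤₚ.+-comm p s) 0<t))
  = a , b , c , d , (refl , refl , refl , refl) , ℤₚ.+-injective (det-ℕ a b c d det)
  , ℤₚ.drop‿+<+ (0<j-i⇒i<j (subst (0ℤ <_) (rearrange₂ (+ a) (+ b) (+ c) (+ d)) 0<diff))
  , ℤₚ.drop‿+<+ (0<j-i⇒i<j (subst (0ℤ <_) (rearrange₁ (+ a) (+ b) (+ c) (+ d)) 0<sum))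

sandwich : ∀ {N k} e e′ (u : Vec Side k) →
           matrix (step e ∙ (word u ∙ step e′)) ≡ matrix N → N ≈ word (e ∷ (u ∷ʳ e′))
sandwich {N} e e′ u eq = PSL.trans {N} {step e ∙ (word u ∙ step e′)} {step e ∙ word (u ∷ʳ e′)} (inj₁ (sym eq))
  (PSL.∙-cong {step e} {step e} {word u ∙ step e′} {word (u ∷ʳ e′)} (PSL.refl {step e})
    (PSL.sym {word (u ∷ʳ e′)} {word u ∙ step e′} (word-∷ʳ u e′)))

inner-outer-IsWord : ∀ {x y z w} → IsWord x y z w → ∃[ k ] Σ[ u ∈ Vec Side k ]
  matrix (step inner ∙ (word u ∙ step outer)) ≡
    mat (+ x) (+ (x ℕ.+ y)) (+ (x ℕ.+ z)) (+ (x ℕ.+ y ℕ.+ z ℕ.+ w))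
inner-outer-IsWord {x} {y} {z} {w} (k , u , eq) = k , u , trans
  (cong (λ Y → matrix (step inner) ∙ₘ (Y ∙ₘ matrix (step outer))) eq) (trans
  (cong (matrix (step inner) ∙ₘ_) (∙ₘ-outer (+ x) (+ y) (+ z) (+ w))) (trans
  (inner-∙ₘ (+ x) (+ x + + y) (+ z) (+ z + + w))
  (mat-cong refl refl refl (cong +_ (sym (ℕ.+-assoc (x ℕ.+ y) z w))))))

outer-inner-IsWord : ∀ {x y z w} → IsWord w z y x → ∃[ k ] Σ[ u ∈ Vec Side k ]
  matrix (step outer ∙ (word u ∙ step inner)) ≡
    mat (+ (x ℕ.+ y ℕ.+ z ℕ.+ w)) (+ (x ℕ.+ z)) (+ (x ℕ.+ y)) (+ x)
outer-inner-IsWord {x} {y} {z} {w} (k , u , eq) = k , u , trans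
  (cong (λ Y → matrix (step outer) ∙ₘ (Y ∙ₘ matrix (step inner))) eq) (trans
  (cong (matrix (step outer) ∙ₘ_) (∙ₘ-inner (+ w) (+ z) (+ y) (+ x))) (trans
  (outer-∙ₘ (+ w + + z) (+ z) (+ y + + x) (+ x))
  (mat-cong (reorder (+ x) (+ y) (+ z) (+ w)) (ℤₚ.+-comm (+ z) (+ x)) (ℤₚ.+-comm (+ y) (+ x)) refl)))
  where
  reorder : ∀ x y z w → (w + z) + (y + x) ≡ x + y + z + w
  reorder = solve-∀

inner-outer-factor : ∀ p q r s → p * s - q * r ≡ 1ℤ → 0ℤ < p + s → Balanced (fixedForm (mat p q r s)) →
  ∃[ k ] Σ[ u ∈ Vec Side k ] matrix (step inner ∙ (word u ∙ step outer)) ≡ mat p q r s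
inner-outer-factor p q r s det 0<t bal
  with a , b , c , d , (refl , refl , refl , refl) , det-ℕ , lt , lt′ ← natural-entries p q r s det 0<t bal
  with x , y , z , w , refl , refl , refl , refl , det′ ← factor-period a b c d det-ℕ lt lt′
  = inner-outer-IsWord (det≡1⇒IsWord _ x y z w ℕ.≤-refl det′)

-- Conjugation by (0 1; 1 0) gives a matrix a half turn and exchanges L and T. The factorisation L⋯T
-- of (s r; q p) thus yields the one of shape T⋯L here, with the entries of the middle factor in
-- reverse order.
outer-inner-factor : ∀ p q r s → s * p - r * q ≡ 1ℤ → 0ℤ < s + p → Balanced (fixedForm (mat s r q p)) →
  ∃[ k ] Σ[ u ∈ Vec Side k ] matrix (step outer ∙ (word u ∙ step inner)) ≡ mat p q r s
outer-inner-factor p q r s det 0<t bal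
  with a , b , c , d , (refl , refl , refl , refl) , det-ℕ , lt , lt′ ← natural-entries s r q p det 0<t bal
  with x , y , z , w , refl , refl , refl , refl , det′ ← factor-period a b c d det-ℕ lt lt′
  = outer-inner-IsWord (det≡1⇒IsWord _ w z y x ℕ.≤-refl
      (trans (ℕ.*-comm w x) (trans det′ (cong suc (ℕ.*-comm y z)))))

Balanced⇒word : ∀ N → 0ℤ < trace (matrix N) → Balanced (fixedForm (matrix N)) →
                ∃[ k ] Σ[ u ∈ Vec Side k ] N ≈ word (inner ∷ (u ∷ʳ outer))
Balanced⇒word N@(⟪ mat p q r s , det ⟫) 0<t bal =
  let k , u , eq = inner-outer-factor p q r s det 0<t bal in k , u , sandwich {N} inner outer u eq

flip-Balanced⇒word : ∀ N → 0ℤ < trace (matrix N) → Balanced (flip (S · fixedForm (matrix N))) →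
                     ∃[ k ] Σ[ u ∈ Vec Side k ] N ≈ word (outer ∷ (u ∷ʳ inner))
flip-Balanced⇒word N@(⟪ mat p q r s , det ⟫) 0<t bal =
  let k , u , eq = outer-inner-factor p q r s (trans (det-swap p q r s) det)
                     (subst (0ℤ <_) (ℤₚ.+-comm p s) 0<t)
                     (subst Balanced flip-S bal)
  in k , u , sandwich {N} outer inner u eq
  where
  det-swap : ∀ p q r s → s * p - r * q ≡ p * s - q * r
  det-swap = solve-∀
  -- On fixed forms, conjugation by (0 1; 1 0) is g ↦ `flip (S · g)`.
  flip-S : flip (S · fixedForm (mat p q r s)) ≡ fixedForm (mat s r q p)
  flip-S = trans (cong flip (S-· r (s - p) (- q))) (form-cong (ℤₚ.neg-involutive q) (neg-sub s p) refl)

-- As sgn 0 = 0, trace 0 would make `orientedForm` vanish, and with it a positive multiple of f,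
-- whose discriminant is positive.
trace≢0 : ∀ {f M} → Indefinite f → IsM f M → ¬ trace (matrix M) ≡ 0ℤ
trace≢0 {form A B C} {⟪ mat p q r s , _ ⟫} 0<Δ isM t≡0 with n , m , 0<n , 0<m , eq ← IsM⇒∝ isM =
  ℤₚ.<-irrefl (trans (sym (cancel n r (s - p) (- q)))
      (cong Δ (trans (cong (λ t → n ⊛ sgn t ⊛ form r (s - p) (- q)) (sym t≡0)) eq)))
    (subst (0ℤ <_) (sym (Δ-⊛ m A B C)) (pos*pos (pos*pos 0<m 0<m) 0<Δ))
  where
  cancel : ∀ n A B C → (n * (0ℤ * B)) * (n * (0ℤ * B)) - + 4 * ((n * (0ℤ * A)) * (n * (0ℤ * C))) ≡ 0ℤ
  cancel = solve-∀
  Δ-⊛ : ∀ m A B C → (m * B) * (m * B) - + 4 * ((m * A) * (m * C)) ≡ (m * m) * (B * B - + 4 * (A * C))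
  Δ-⊛ = solve-∀

positive-trace : ∀ N → ¬ trace (matrix N) ≡ 0ℤ → ∃[ N′ ] N ≈ N′ × 0ℤ < trace (matrix N′)
positive-trace N@(⟪ mat p q r s , det ⟫) t≢0 = by-sign (p + s) refl
  where
  det-neg : ∀ p q r s → (- p) * (- s) - (- q) * (- r) ≡ p * s - q * r
  det-neg = solve-∀

  by-sign : ∀ t → p + s ≡ t → ∃[ N′ ] N ≈ N′ × 0ℤ < trace (matrix N′)
  by-sign +0       eq = contradiction eq t≢0
  by-sign +[1+ n ] eq = N , inj₁ refl , subst (0ℤ <_) (sym eq) 0<+[1+ n ]
  by-sign -[1+ n ] eq = ⟪ mat (- p) (- q) (- r) (- s) , trans (det-neg p q r s) det ⟫
    , inj₂ (mat-cong (sym (ℤₚ.neg-involutive p)) (sym (ℤₚ.neg-involutive q))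
                     (sym (ℤₚ.neg-involutive r)) (sym (ℤₚ.neg-involutive s)))
    , subst (0ℤ <_) (sym (trans (neg-+ p s) (cong -_ eq))) 0<+[1+ n ]

module _ {M : SL₂} (γ : Axis M) where
  open Axis γ

  inner-outer-ReducedOn : ∀ W → W ≈ into 0ℤ → ToInner γ 0ℤ → ToOuter γ -[1+ 0 ] → ReducedOn γ W
  inner-outer-ReducedOn W W≈into i o = 0ℤ , i , inj₁ (W≈into , o)

  outer-inner-ReducedOn : ∀ W → W ∙ S ≈ into 0ℤ → ToOuter γ 0ℤ → ToInner γ -[1+ 0 ] → ReducedOn γ W
  outer-inner-ReducedOn W WS≈into o i = -[1+ 0 ] , i , inj₂ (W≈from , o)
    where
    W≈from : W ≈ from -[1+ 0 ]
    W≈from = ∙-cancelʳ S W (from -[1+ 0 ]) (PSL.trans {W ∙ S} {into 0ℤ} {from -[1+ 0 ] ∙ S} WS≈into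
      (Meet⊗⇒S {from -[1+ 0 ]} {into 0ℤ} (at⊗ -[1+ 0 ])))

module _ {M : SL₂} {k} (u : Vec Side k) where

  inner-outer-axis : ∀ W → M ∙ W ≈ W ∙ word (inner ∷ (u ∷ʳ outer)) → Σ[ γ ∈ Axis M ] ReducedOn γ W
  inner-outer-axis W period =
    let γ , W≈into , to = periodicAxis {M} {W} (inner ∷ (u ∷ʳ outer)) period
    in γ , inner-outer-ReducedOn γ W W≈into (to 0ℤ {inner} refl)
         (to -[1+ 0 ] {outer} (cyclic-last (inner ∷ u) outer))

  outer-inner-axis : ∀ W → M ∙ (W ∙ S) ≈ (W ∙ S) ∙ word (outer ∷ (u ∷ʳ inner)) →
                     Σ[ γ ∈ Axis M ] ReducedOn γ W
  outer-inner-axis W period =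
    let γ , WS≈into , to = periodicAxis {M} {W ∙ S} (outer ∷ (u ∷ʳ inner)) period
    in γ , outer-inner-ReducedOn γ W WS≈into (to 0ℤ {outer} refl)
         (to -[1+ 0 ] {inner} (cyclic-last (outer ∷ u) inner))

module _ {f : Form} {M : SL₂} (0<Δ : Indefinite f) (isM : IsM f M) where

  period-at : ∀ V → ∃[ N ] M ∙ V ≈ V ∙ N × 0ℤ < trace (matrix N) × fixedForm (matrix N) ∝ V · f
  period-at V =
    let N , eq , 0<t = positive-trace (V ⁻¹ ∙ (M ∙ V))
          (λ t≡0 → trace≢0 0<Δ isM (trans (sym (trace-conj V M)) t≡0))
    in N , conjugate⁻¹ {M} {V} {N} eq , 0<t
         , fixedForm-∝ {V ⁻¹ ∙ (M ∙ V)} {N} eq 0<t (orientedForm-conj-∝ V isM)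

  private
    spell : ∀ {V N k} (u : Vec Side k) → M ∙ V ≈ V ∙ N → N ≈ word u → M ∙ V ≈ V ∙ word u
    spell {V} {N} u p q = PSL.trans {M ∙ V} {V ∙ N} {V ∙ word u} p
      (PSL.∙-cong {V} {V} {N} {word u} (PSL.refl {V}) q)

    S-WS : ∀ W → S · (W ∙ S) · f ≡ W · f
    S-WS W = trans (·-∙ S (W ∙ S) f) (·-congˡ {(W ∙ S) ∙ S} {W} f (undo W {S} (inj₂ refl)))

    inner-outer-spelled : ∀ W N → M ∙ W ≈ W ∙ N → ∃[ k ] Σ[ u ∈ Vec Side k ] N ≈ word (inner ∷ (u ∷ʳ outer)) →
                          Σ[ γ ∈ Axis M ] ReducedOn γ W
    inner-outer-spelled W N period (_ , u , N≈u) =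
      inner-outer-axis u W (spell {W} {N} (inner ∷ (u ∷ʳ outer)) period N≈u)

    outer-inner-spelled : ∀ W N → M ∙ (W ∙ S) ≈ (W ∙ S) ∙ N →
                          ∃[ k ] Σ[ u ∈ Vec Side k ] N ≈ word (outer ∷ (u ∷ʳ inner)) →
                          Σ[ γ ∈ Axis M ] ReducedOn γ W
    outer-inner-spelled W N period (_ , u , N≈u) =
      outer-inner-axis u W (spell {W ∙ S} {N} (outer ∷ (u ∷ʳ inner)) period N≈u)

  Balanced⇒ReducedOn : ∀ W → Balanced (W · f) → Σ[ γ ∈ Axis M ] ReducedOn γ W
  Balanced⇒ReducedOn W bal = conclude (period-at W)
    where
    conclude : ∃[ N ] M ∙ W ≈ W ∙ N × 0ℤ < trace (matrix N) × fixedForm (matrix N) ∝ W · f →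
               Σ[ γ ∈ Axis M ] ReducedOn γ W
    conclude (N , period , 0<t , N∝) =
      inner-outer-spelled W N period (Balanced⇒word N 0<t (Balanced-∝ (∝-sym N∝) bal))

  flip-Balanced⇒ReducedOn : ∀ W → Balanced (flip (W · f)) → Σ[ γ ∈ Axis M ] ReducedOn γ W
  flip-Balanced⇒ReducedOn W bal = conclude (period-at (W ∙ S))
    where
    conclude : ∃[ N ] M ∙ (W ∙ S) ≈ (W ∙ S) ∙ N ×
                 0ℤ < trace (matrix N) × fixedForm (matrix N) ∝ (W ∙ S) · f →
               Σ[ γ ∈ Axis M ] ReducedOn γ W
    conclude (N , period , 0<t , N∝) = outer-inner-spelled W N period (flip-Balanced⇒word N 0<t
      (Balanced-∝ (flip-∝ (·-∝ S (∝-sym N∝))) (subst (λ g → Balanced (flip g)) (sym (S-WS W)) bal)))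

  Reduced⇒ReducedOn : ∀ W → Reduced (W · f) → Σ[ γ ∈ Axis M ] ReducedOn γ W
  Reduced⇒ReducedOn W red with Reduced⇒Balanced (W · f) red
  ... | inj₁ bal = Balanced⇒ReducedOn W bal
  ... | inj₂ bal = flip-Balanced⇒ReducedOn W bal

-- The labelling of the edges of the çark by forms

^ℕ-fixes : ∀ {f} U → U · f ≡ f → ∀ n → (U ^ℕ n) · f ≡ f
^ℕ-fixes {f} U fix zero    = 𝟙-· f
^ℕ-fixes {f} U fix (suc n) =
  trans (sym (·-∙ (U ^ℕ n) U f)) (trans (cong ((U ^ℕ n) ·_) fix) (^ℕ-fixes U fix n))

^-fixes : ∀ {f} M → M · f ≡ f → ∀ k → (M ^ k) · f ≡ f
^-fixes     M fix (+ n)    = ^ℕ-fixes M fix n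
^-fixes {f} M fix -[1+ n ] = ^ℕ-fixes (M ⁻¹) M⁻¹-fixes (suc n)
  where
  M⁻¹-fixes : (M ⁻¹) · f ≡ f
  M⁻¹-fixes = trans (cong ((M ⁻¹) ·_) (sym fix))
    (trans (·-∙ (M ⁻¹) M f) (trans (·-congˡ {M ∙ M ⁻¹} {𝟙} f (PSL.inverseʳ M)) (𝟙-· f)))

module _ {f : Form} {M : SL₂} (isM : IsM f M) where
  open IsM isM using (fixes; generates)
  open Setoid (ÇarkEdges M) using () renaming (_≈_ to _∼_)

  label-cong : ∀ {U V} → U ∼ V → U · f ≡ V · f
  label-cong {U} {V} (k , V≈MᵏU) = sym (trans (·-congˡ {V} {M ^ k ∙ U} f V≈MᵏU)
    (trans (sym (·-∙ U (M ^ k) f)) (cong (U ·_) (^-fixes M fixes k))))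

  private
    quotient-fixes : ∀ U V → U · f ≡ V · f → (V ∙ U ⁻¹) · f ≡ f
    quotient-fixes U V Uf≡Vf = trans (sym (·-∙ (U ⁻¹) V f)) (trans (cong ((U ⁻¹) ·_) (sym Uf≡Vf))
      (trans (·-∙ (U ⁻¹) U f) (trans (·-congˡ {U ∙ U ⁻¹} {𝟙} f (PSL.inverseʳ U)) (𝟙-· f))))

  -- `V ∙ U ⁻¹` stabilises f, and the stabiliser consists of the powers of M.
  label-injective : ∀ {U V} → U · f ≡ V · f → U ∼ V
  label-injective {U} {V} Uf≡Vf = conclude (generates (V ∙ U ⁻¹) (quotient-fixes U V Uf≡Vf))
    where
    conclude : ∃[ k ] V ∙ U ⁻¹ ≈ M ^ k → ∃[ k ] V ≈ M ^ k ∙ U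
    conclude (k , VU⁻¹≈Mᵏ) = k , PSL.trans {V} {(V ∙ U ⁻¹) ∙ U} {M ^ k ∙ U}
      (PSL.sym {(V ∙ U ⁻¹) ∙ U} {V} (//-rightDividesˡ U V))
      (PSL.∙-cong {V ∙ U ⁻¹} {M ^ k} {U} {U} VU⁻¹≈Mᵏ (PSL.refl {U}))

theorem4p4 : (f : Form) → Indefinite f → NonSquare (Δ f) → (M : SL₂) → IsM f M →
    Σ[ φ ∈ Bijection (ReducedEdges M) (ReducedForms f) ]
    (∀ (e : Setoid.Carrier (ReducedEdges M)) → proj₁ (Bijection.to φ e) ≡ proj₁ e · f)
theorem4p4 f 0<Δ _ M isM = φ , λ _ → refl
  where
  module Ç = Setoid (ÇarkEdges M)

  φ : Bijection (ReducedEdges M) (ReducedForms f)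
  φ = record
    { to        = λ { (W , V , W∼V , γ , reduced) → W · f , (W , refl) ,
                      subst Reduced (sym (label-cong isM {W} {V} W∼V)) (ReducedOn⇒Reduced isM γ V reduced) }
    ; cong      = λ { {U , _} {V , _} U∼V → label-cong isM {U} {V} U∼V }
    ; bijective = (λ { {U , _} {V , _} eq → label-injective isM {U} {V} eq })
                -- The matrix U that exhibits g as a member of the class serves both as the edge and
                -- as its reduced lift.
                , λ { (g , (U , g≡Uf) , reduced) →
                      (U , U , Ç.refl {U} , Reduced⇒ReducedOn 0<Δ isM U (subst Reduced g≡Uf reduced))
                    , λ { {V , _} V∼U → trans (label-cong isM {V} {U} V∼U) (sym g≡Uf) } }
    }
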